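{- Let $p:Y\to X$ be a Galois cover of finite graphs with Galois group $\mathrm{Gal}(Y/X)\cong\mathfrak S_3$. Let $Q=Y/\langle(1,2,3)\rangle$ and $T=Y/\langle(1,2)\rangle$ be the intermediate covers corresponding to the cyclic subgroups $C_3=\langle(1,2,3)\rangle$ and $C_2=\langle(1,2)\rangle$ of $\mathfrak S_3$, respectively. Then the Ihara zeta functions satisfy \[ \zeta_Y(u)\,\zeta_X(u)^2=\zeta_Q(u)\,\zeta_T(u)^2 . \]
   Context: Graphs are finite simple graphs. A covering map $p:\tilde X\to X$ is a surjective graph morphism such that for every vertex $\tilde v$ of $\tilde X$, $p$ induces a bijection from the set of edges incident to $\tilde v$ to the set of edges incident to $p(\tilde v)$. A cover $p:\tilde X\to X$ is Galois with Galois group $G=\mathrm{Gal}(\tilde X/X)$ if $G$ acts on $\tilde X$ (by graph automorphisms), acts freely and transitively on each fiber $p^{ -1}(w)$, $w\in V(X)$, and $\tilde X/G$ is isomorphic to $X$. For a subgroup $H\le G$, the quotient graph $\tilde X/H$ has the $H$-orbits of vertices as vertices, two orbits being adjacent iff some representatives are adjacent; it is an intermediate cover $\tilde X\to\tilde X/H\to X$. Ihara zeta function: view a graph $\Gamma$ as a bidirected graph, each edge being replaced by two directed edges of opposite directions; $\overline e$ denotes the opposite of the directed edge $e$. A cycle $C=(e_0,\dots,e_{l-1})$ is a closed walk of directed edges (the terminal vertex of $e_i$ is the initial vertex of $e_{i+1}$, indices in $\mathbb Z/l\mathbb Z$) of length $\nu(C)=l\geq 1$. It is non-backtracking if $e_i\ne\overline{e_{i+1}}$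 for every $i\in\mathbb Z/l\mathbb Z$. A non-backtracking cycle is prime if it is not of the form $D^k$ for a cycle $D$ and an integer $k>1$. Two prime cycles are equivalent if one is obtained from the other by a cyclic shift $(e_k,e_{k+1},\dots,e_{k+l-1})$; an equivalence class $[C]$ is called a prime of $\Gamma$. The zeta function is \[ \zeta_\Gamma(u)=\prod_{[C]}\bigl(1-u^{\nu(C)}\bigr)^{ -1}, \] the product running over all primes $[C]$ of $\Gamma$ (as a formal power series in $u$, or equivalently a function for $|u|$ small). -}

module Defs where

open import Algebra.Bundles using (Group)
open import Algebra.Morphism.Structures using (module GroupMorphisms)
import Algebra.Properties.Group as GroupProperties
import Algebra.Properties.Semiring.Sum as Sum
open import Data.Bool.Base using (if_then_else_)
open import Data.Empty.Polymorphic using (⊥)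
open import Data.Fin.Base using (Fin; toℕ; fromℕ<; punchIn)
open import Data.Fin.Patterns using (0F; 1F; 2F)
import Data.Fin.Permutation as Perm
open Perm using (Permutation′; permutation; transpose; _⟨$⟩ʳ_; _⟨$⟩ˡ_; _∘ₚ_)
import Data.Fin.Properties as Fin
open import Data.Integer.Base as ℤ using (ℤ; 0ℤ; 1ℤ)
import Data.Integer.Properties as ℤ
open import Data.Irrelevant using ([_])
open import Data.List.Base as List
  using (List; []; _∷_; _++_; _∷ʳ_; length; take; drop; concat; replicate; concatMap;
         mapMaybe; filter; deduplicate; find; foldr; applyUpTo; cartesianProduct;
         cartesianProductWith)
open import Data.List.Membership.Propositional using (_∈_)
open import Data.List.Membership.Propositional.Properties using (∈-map⁺)
import Data.List.Properties as List
open import Data.List.Relation.Unary.All as All using (All; []; _∷_)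
open import Data.List.Relation.Unary.Any as Any using (Any; here; there)
open import Data.List.Relation.Unary.Enumerates.Setoid using (IsEnumeration)
open import Data.List.Relation.Unary.Linked using (Linked; linked?)
open import Data.Maybe.Base as Maybe using (fromMaybe)
open import Data.Nat.Base as ℕ using (ℕ; zero; suc; _∸_; _≤_; _<_; s≤s; z≤n; NonZero)
open import Data.Nat.Divisibility as ℕ using (_∣?_)
import Data.Nat.Properties as ℕ
open import Data.Product.Base using (∃; ∃₂; _×_; _,_; proj₁; proj₂; swap)
import Data.Product.Properties as Product
open import Data.Refinement as Refinement using (Refinement-syntax; value; _,_)
import Data.Refinement.Properties as Refinement
open import Data.Unit.Base using (⊤; tt)
open import Function.Base using (_∘_)
open import Function.Bundles using (_↔_; Inverse; _⇔_; mk⇔; Equivalence)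
open import Function.Definitions using (Surjective; Bijective)
open import Level using (Level; 0ℓ; _⊔_) renaming (suc to lsuc)
open import Relation.Binary.Core using (Rel)
open import Relation.Binary.Definitions using (Decidable; DecidableEquality; Symmetric; Irreflexive)
open import Relation.Binary.PropositionalEquality
  using (_≡_; _≢_; refl; sym; trans; cong; subst; subst₂; setoid; module ≡-Reasoning)
open import Relation.Nullary using (¬_; Dec; yes; no; does; recompute; contradiction)
open import Relation.Nullary.Decidable as Dec
  using (dec⇒maybe; ¬?; _×-dec_; from-yes; dec-true; dec-false; does-⇔)
open import Relation.Unary as Unary using (Pred)

open Sum ℤ.+-*-semiring using (sum; sum⁺-syntax)

private
  variable
    a c ℓ p : Level
    A : Set a

record Graph : Set₁ where
  infix 4 _≟_
  field
    V          : Set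
    _≟_        : DecidableEquality V
    vertices   : List V
    enumerates : IsEnumeration (setoid V) vertices
    Adj        : Rel V 0ℓ
    adj?       : Decidable Adj
    adj-sym    : Symmetric Adj
    adj-irrefl : Irreflexive _≡_ Adj

  any-vertex? : {P : Pred V p} → Unary.Decidable P → Dec (∃ P)
  any-vertex? P? = Dec.map′ Any.satisfied
    (λ { (v , Pv) → Any.map (λ { refl → Pv }) (enumerates v) })
    (Any.any? P? vertices)

open Graph using (V; Adj)

record _≅_ (Γ Δ : Graph) : Set where
  field
    bijection : V Γ ↔ V Δ
    adj⇔      : ∀ {v w} → Adj Γ v w ⇔ Adj Δ (Inverse.to bijection v) (Inverse.to bijection w)

PowerSeries : Set
PowerSeries = ℕ → ℤ

infix 4 _≋_
_≋_ : Rel PowerSeries 0ℓ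
f ≋ g = ∀ n → f n ≡ g n

infixl 6 _⊖_
_⊖_ : PowerSeries → PowerSeries → PowerSeries
(f ⊖ g) n = f n ℤ.- g n

infixl 7 _⊛_
_⊛_ : PowerSeries → PowerSeries → PowerSeries
(f ⊛ g) n = ∑[ i ≤ n ] (f (toℕ i) ℤ.* g (n ∸ toℕ i))

u^_ : ℕ → PowerSeries
(u^ k) n = if does (k ℕ.≟ n) then 1ℤ else 0ℤ

𝟙 : PowerSeries
𝟙 = u^ 0

∏ : List PowerSeries → PowerSeries
∏ = foldr _⊛_ 𝟙

-- The series (1 - uᵏ)⁻¹ for k ≥ 1; `geometric-inverse` shows that this
-- is what it is.

geometric : ℕ → PowerSeries
geometric k n = if does (k ∣? n) then 1ℤ else 0ℤ

private
  ⊛-distrib : ∀ f h g n → ((f ⊖ h) ⊛ g) n ≡ (f ⊛ g) n ℤ.- (h ⊛ g) n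
  ⊛-distrib f h g n = begin
    D                ≡⟨ ℤ.+-identityʳ D ⟨
    D ℤ.+ 0ℤ         ≡⟨ cong (λ x → D ℤ.+ x) (ℤ.+-inverseʳ H) ⟨
    D ℤ.+ (H ℤ.- H)  ≡⟨ ℤ.+-assoc D H (ℤ.- H) ⟨
    D ℤ.+ H ℤ.- H    ≡⟨ cong (ℤ._- H) D+H≡F ⟩
    (f ⊛ g) n ℤ.- H  ∎
    where
    open ≡-Reasoning
    D = ((f ⊖ h) ⊛ g) n
    H = (h ⊛ g) n
    cancel : ∀ x y z → (x ℤ.- y) ℤ.* z ℤ.+ y ℤ.* z ≡ x ℤ.* z
    cancel x y z = trans (sym (ℤ.*-distribʳ-+ z (x ℤ.- y) y))
      (cong (ℤ._* z) (trans (ℤ.+-assoc x (ℤ.- y) y)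
        (trans (cong (λ w → x ℤ.+ w) (ℤ.+-inverseˡ y)) (ℤ.+-identityʳ x))))
    D+H≡F : D ℤ.+ H ≡ (f ⊛ g) n
    D+H≡F = trans
      (sym (Sum.∑-distrib-+ ℤ.+-*-semiring {suc n}
        (λ i → (f ⊖ h) (toℕ i) ℤ.* g (n ∸ toℕ i)) (λ i → h (toℕ i) ℤ.* g (n ∸ toℕ i))))
      (Sum.sum-cong-≗ ℤ.+-*-semiring {suc n}
        (λ i → cancel (f (toℕ i)) (h (toℕ i)) (g (n ∸ toℕ i))))

  sum-zero : ∀ {n} (t : Fin n → ℤ) → (∀ i → t i ≡ 0ℤ) → sum t ≡ 0ℤ
  sum-zero {n} t t≡0 = trans (Sum.sum-cong-≗ ℤ.+-*-semiring {n} t≡0)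
    (Sum.sum-replicate-zero ℤ.+-*-semiring n)

  u^-≢ : ∀ {k n} → k ≢ n → (u^ k) n ≡ 0ℤ
  u^-≢ {k} {n} k≢n = cong (if_then 1ℤ else 0ℤ) (dec-false (k ℕ.≟ n) k≢n)

  u^-≡ : ∀ k → (u^ k) k ≡ 1ℤ
  u^-≡ k = cong (if_then 1ℤ else 0ℤ) (dec-true (k ℕ.≟ k) refl)

  shift-> : ∀ {k n} g → n < k → ((u^ k) ⊛ g) n ≡ 0ℤ
  shift-> {k} {n} g n<k = sum-zero {suc n} _ λ i → cong (ℤ._* g (n ∸ toℕ i))
    (u^-≢ λ k≡i → ℕ.<⇒≱ n<k (subst (_≤ n) (sym k≡i) (Fin.toℕ≤pred[n] i)))

  shift-≤ : ∀ {k n} g → k ≤ n → ((u^ k) ⊛ g) n ≡ g (n ∸ k)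
  shift-≤ {k} {n} g k≤n = begin
    sum t                              ≡⟨ Sum.sum-remove ℤ.+-*-semiring {n} {i} t ⟩
    t i ℤ.+ sum (t ∘ punchIn i)    ≡⟨ cong (λ x → t i ℤ.+ x) (sum-zero {n} _ rest) ⟩
    t i ℤ.+ 0ℤ                         ≡⟨ ℤ.+-identityʳ (t i) ⟩
    t i                                ≡⟨ cong (λ m → (u^ k) m ℤ.* g (n ∸ m)) i≡k ⟩
    (u^ k) k ℤ.* g (n ∸ k)             ≡⟨ cong (ℤ._* g (n ∸ k)) (u^-≡ k) ⟩
    1ℤ ℤ.* g (n ∸ k)                   ≡⟨ ℤ.*-identityˡ _ ⟩
    g (n ∸ k)                          ∎
    where
    open ≡-Reasoning
    i : Fin (suc n)
    i = fromℕ< (s≤s k≤n)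
    i≡k : toℕ i ≡ k
    i≡k = Fin.toℕ-fromℕ< (s≤s k≤n)
    t : Fin (suc n) → ℤ
    t j = (u^ k) (toℕ j) ℤ.* g (n ∸ toℕ j)
    rest : ∀ j → t (punchIn i j) ≡ 0ℤ
    rest j = cong (ℤ._* g (n ∸ toℕ (punchIn i j)))
      (u^-≢ λ k≡ → Fin.punchInᵢ≢i i j (Fin.toℕ-injective (trans (sym k≡) (sym i≡k))))

geometric-inverse : ∀ k .{{_ : NonZero k}} → (𝟙 ⊖ u^ k) ⊛ geometric k ≋ 𝟙
geometric-inverse k n = trans (⊛-distrib 𝟙 (u^ k) (geometric k) n)
  (trans (cong (ℤ._- ((u^ k) ⊛ geometric k) n) (shift-≤ (geometric k) z≤n)) (cases n))
  where
  cases : ∀ n → geometric k n ℤ.- ((u^ k) ⊛ geometric k) n ≡ 𝟙 n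
  cases zero = trans
    (cong (λ x → geometric k 0 ℤ.- x) (shift-> (geometric k) (ℕ.>-nonZero⁻¹ k)))
    (cong (λ b → (if b then 1ℤ else 0ℤ) ℤ.- 0ℤ) (dec-true (k ∣? 0) (k ℕ.∣0)))
  cases n@(suc _) with k ℕ.≤? n
  ... | yes k≤n = trans (cong (λ x → geometric k n ℤ.- x)
          (trans (shift-≤ (geometric k) k≤n)
            (cong (if_then 1ℤ else 0ℤ) (does-⇔ period (k ∣? (n ∸ k)) (k ∣? n)))))
        (ℤ.+-inverseʳ (geometric k n))
    where
    period : (k ℕ.∣ n ∸ k) ⇔ (k ℕ.∣ n)
    period = mk⇔ (λ d → ℕ.∣m∸n∣n⇒∣m k k≤n d ℕ.∣-refl) 
      (λ d → ℕ.∣m+n∣m⇒∣n (subst (k ℕ.∣_) (sym (ℕ.m+[n∸m]≡n k≤n)) d) ℕ.∣-refl)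
  ... | no  k≰n = trans
    (cong (λ x → geometric k n ℤ.- x) (shift-> (geometric k) (ℕ.≰⇒> k≰n)))
    (cong (λ b → (if b then 1ℤ else 0ℤ) ℤ.- 0ℤ) (dec-false (k ∣? n) (k≰n ∘ ℕ.∣⇒≤)))

words : ℕ → List A → List (List A)
words zero    xs = [] ∷ []
words (suc l) xs = cartesianProductWith _∷_ xs (words l xs)

-- R relates every entry to the next one, indices being read modulo the
-- length; the empty list is excluded, as cycles have length at least 1.

Cyclic : {A : Set a} → Rel A ℓ → Pred (List A) (a ⊔ ℓ)
Cyclic R []       = ⊥
Cyclic R (x ∷ xs) = Linked R (x ∷ xs ∷ʳ x)

cyclic? : {A : Set a} {R : Rel A ℓ} → Decidable R → Unary.Decidable (Cyclic R)
cyclic? R? []       = no λ ()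
cyclic? R? (x ∷ xs) = linked? R? (x ∷ xs ∷ʳ x)

infixl 8 _^_
_^_ : List A → ℕ → List A
D ^ k = concat (replicate k D)

-- The cyclic shifts of C of length l ≥ 1 are those by 0, …, l - 1 places.

infix 4 _∼_
_∼_ : {A : Set a} → Rel (List A) a
C ∼ C′ = ∃ λ (k : Fin (length C)) → drop (toℕ k) C ++ take (toℕ k) C ≡ C′

module Ihara (Γ : Graph) where
  open Graph Γ using (vertices; _≟_; adj?; adj-sym)

  DEdge : Set
  DEdge = [ vw ∈ V Γ × V Γ ∣ Adj Γ (proj₁ vw) (proj₂ vw) ]

  source target : DEdge → V Γ
  source = proj₁ ∘ value
  target = proj₂ ∘ value

  opposite : DEdge → DEdge
  opposite = Refinement.map swap adj-sym

  infix 4 _≟ᵉ_ _≟ʷ_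
  _≟ᵉ_ : DecidableEquality DEdge
  _≟ᵉ_ = Refinement._≟_ (Product.≡-dec _≟_ _≟_)

  _≟ʷ_ : DecidableEquality (List DEdge)
  _≟ʷ_ = List.≡-dec _≟ᵉ_

  dedges : List DEdge
  dedges = mapMaybe (λ vw → Maybe.map (λ vw∈E → vw , [ vw∈E ]) (dec⇒maybe (adj? (proj₁ vw) (proj₂ vw))))
    (cartesianProduct vertices vertices)

  Cycle : Pred (List DEdge) 0ℓ
  Cycle = Cyclic (λ e f → target e ≡ source f)

  NonBacktracking : Pred (List DEdge) 0ℓ
  NonBacktracking = Cyclic (λ e f → e ≢ opposite f)

  ProperPower : Pred (List DEdge) 0ℓ
  ProperPower C = ∃₂ λ D k → Cycle D × 1 < k × D ^ k ≡ C

  record PrimeCycle (C : List DEdge) : Set where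
    constructor mkPrimeCycle
    field
      isCycle         : Cycle C
      nonBacktracking : NonBacktracking C
      ¬properPower    : ¬ ProperPower C

  cycle? : Unary.Decidable Cycle
  cycle? = cyclic? (λ e f → target e ≟ source f)

  private
    length-^ : ∀ (D : List DEdge) k → length (D ^ k) ≡ k ℕ.* length D
    length-^ D zero    = refl
    length-^ D (suc k) = trans (List.length-++ D) (cong (length D ℕ.+_) (length-^ D k))

    take-length-++ : ∀ (D E : List DEdge) → take (length D) (D ++ E) ≡ D
    take-length-++ []      E = refl
    take-length-++ (e ∷ D) E = cong (e ∷_) (take-length-++ D E)

  properPower? : Unary.Decidable ProperPower
  properPower? C = Dec.map′
    (λ { (d , k , h) → take (toℕ d) C , toℕ k , h })
    bounded
    (Fin.any? {suc (length C)} λ d → Fin.any? {suc (length C)} λ k →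
      cycle? (take (toℕ d) C) ×-dec 1 ℕ.<? toℕ k ×-dec (take (toℕ d) C ^ toℕ k ≟ʷ C))
    where
    Bounded : Set
    Bounded = ∃₂ λ (d k : Fin (suc (length C))) →
      Cycle (take (toℕ d) C) × 1 < toℕ k × take (toℕ d) C ^ toℕ k ≡ C

    build : ∀ d k → d < suc (length C) → k < suc (length C) →
            Cycle (take d C) → 1 < k → take d C ^ k ≡ C → Bounded
    build d k d< k< cyc 1<k eq = fromℕ< d< , fromℕ< k< ,
      subst₂ (λ d k → Cycle (take d C) × 1 < k × take d C ^ k ≡ C)
        (sym (Fin.toℕ-fromℕ< d<)) (sym (Fin.toℕ-fromℕ< k<)) (cyc , 1<k , eq)

    bounded : ProperPower C → Bounded
    bounded (D@(_ ∷ _) , k@(suc _) , cyc , 1<k , refl) = build (length D) k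
      (s≤s (subst (length D ≤_) (sym (length-^ D k)) (ℕ.m≤n*m (length D) k)))
      (s≤s (subst (k ≤_) (sym (length-^ D k)) (ℕ.m≤m*n k (length D))))
      (subst Cycle (sym take≡) cyc) 1<k (cong (_^ k) take≡)
      where take≡ = take-length-++ D (D ^ ℕ.pred k)

  primeCycle? : Unary.Decidable PrimeCycle
  primeCycle? C = Dec.map′
    (λ { (c , nb , np) → mkPrimeCycle c nb np })
    (λ { (mkPrimeCycle c nb np) → c , nb , np })
    (cycle? C ×-dec cyclic? (λ e f → ¬? (e ≟ᵉ opposite f)) C ×-dec ¬? (properPower? C))

  _∼?_ : Decidable {A = List DEdge} _∼_
  C ∼? C′ = Fin.any? λ k → (drop (toℕ k) C ++ take (toℕ k) C) ≟ʷ C′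

  -- One representative of each prime of length l.

  primes : ℕ → List (List DEdge)
  primes l = deduplicate _∼?_ (filter primeCycle? (words l dedges))

-- A prime of length ν contributes a factor 1 + O(u^ν), so the coefficient
-- of uⁿ in the product over all primes is that in the product over the
-- finitely many primes of length at most n.

ζ : Graph → PowerSeries
ζ Γ n = ∏ (List.map (geometric ∘ length) (concatMap primes (applyUpTo suc n))) n
  where open Ihara Γ

module _ (Γ : Graph) where

  -- In a simple graph, the edges incident to v correspond to the
  -- neighbours of v.

  Star : V Γ → Set
  Star v = [ w ∈ V Γ ∣ Adj Γ v w ]

record Cover (Y X : Graph) : Set where
  field
    map        : V Y → V X
    map-adj    : ∀ {v w} → Adj Y v w → Adj X (map v) (map w)
    surjective : Surjective _≡_ _≡_ map

  star-map : ∀ v → Star Y v → Star X (map v)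
  star-map v = Refinement.map map map-adj

  field
    star-bijective : ∀ v → Bijective _≡_ _≡_ (star-map v)

record DecSubgroup (G : Group c ℓ) (p : Level) : Set (c ⊔ ℓ ⊔ lsuc p) where
  open Group G
  field
    member    : Pred Carrier p
    member?   : Unary.Decidable member
    resp      : ∀ {g h} → g ≈ h → member g → member h
    ε-closed  : member ε
    ∙-closed  : ∀ {g h} → member g → member h → member (g ∙ h)
    ⁻¹-closed : ∀ {g} → member g → member (g ⁻¹)

whole : (G : Group c ℓ) → DecSubgroup G 0ℓ
whole G = record { member = λ _ → ⊤ ; member? = λ _ → yes tt }

record FibrewiseRegularAction {Y X : Graph} (cover : Cover Y X) (G : Group c ℓ) : Set (c ⊔ ℓ) where
  open Group G
  private module P = Cover cover
  infixr 7 _·_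
  field
    _·_        : Carrier → V Y → V Y
    ·-cong     : ∀ {g h} → g ≈ h → ∀ v → g · v ≡ h · v
    ε-act      : ∀ v → ε · v ≡ v
    ∙-act      : ∀ g h v → (g ∙ h) · v ≡ g · h · v
    ·-adj      : ∀ g {v w} → Adj Y v w → Adj Y (g · v) (g · w)
    ·-fibre    : ∀ g v → P.map (g · v) ≡ P.map v
    free       : ∀ {g v} → g · v ≡ v → g ≈ ε
    transitive : ∀ {v w} → P.map v ≡ P.map w → ∃ λ g → g · v ≡ w

module Quotient {Y X : Graph} {cover : Cover Y X} {G : Group c ℓ}
                (action : FibrewiseRegularAction cover G) (H : DecSubgroup G p) where
  open Group G hiding (refl; sym; trans; setoid)
  open GroupProperties G using (⁻¹-involutive; inverseʳ-unique)
  open FibrewiseRegularAction action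
  open DecSubgroup H
  private
    module P = Cover cover
    module X = Graph X
    module Y = Graph Y

  SameOrbit : Rel (V Y) (c ⊔ p)
  SameOrbit v w = ∃ λ h → member h × h · v ≡ w

  private
    inverse-act : ∀ g v → g ⁻¹ · g · v ≡ v
    inverse-act g v = trans (sym (∙-act (g ⁻¹) g v)) (trans (·-cong (inverseˡ g) v) (ε-act v))

    same-refl : ∀ {v} → SameOrbit v v
    same-refl {v} = ε , ε-closed , ε-act v

    same-sym : ∀ {v w} → SameOrbit v w → SameOrbit w v
    same-sym {v} (h , h∈H , refl) = h ⁻¹ , ⁻¹-closed h∈H , inverse-act h v

    same-trans : ∀ {u v w} → SameOrbit u v → SameOrbit v w → SameOrbit u w
    same-trans {u} (h , h∈H , refl) (k , k∈H , refl) = k ∙ h , ∙-closed k∈H h∈H , ∙-act k h u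

    same⇒fibre : ∀ {v w} → SameOrbit v w → P.map v ≡ P.map w
    same⇒fibre {v} (h , _ , refl) = sym (·-fibre h v)

    unique : ∀ {g h v} → g · v ≡ h · v → g ≈ h
    unique {g} {h} {v} gv≡hv = Group.trans G (Group.sym G (⁻¹-involutive g))
      (Group.trans G (⁻¹-cong eq) (⁻¹-involutive h))
      where
      eq : g ⁻¹ ≈ h ⁻¹
      eq = Group.sym G (inverseʳ-unique _ _
        (free {v = g · v} (trans (∙-act g (h ⁻¹) _)
          (trans (cong (λ x → g · h ⁻¹ · x) gv≡hv) (cong (g ·_) (inverse-act h v))))))

  sameOrbit? : Decidable SameOrbit
  sameOrbit? v w with P.map v X.≟ P.map w
  ... | no  pv≢pw = no (pv≢pw ∘ same⇒fibre)
  ... | yes pv≡pw with g , gv≡w ← transitive pv≡pw = Dec.map′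
    (λ g∈H → g , g∈H , gv≡w)
    (λ (h , h∈H , hv≡w) → resp (unique (trans hv≡w (sym gv≡w))) h∈H)
    (member? g)

  -- An orbit is encoded by its first element in the enumeration of the
  -- vertices of Y.

  first : V Y → V Y
  first v = fromMaybe v (find (sameOrbit? v) Y.vertices)

  private
    find-sound : ∀ {P : Pred (V Y) a} (P? : Unary.Decidable P) {xs} → Any P xs →
                 ∀ d → P (fromMaybe d (find P? xs))
    find-sound P? {x ∷ xs} any d with P? x
    ... | yes Px = Px
    ... | no ¬Px with any
    ...   | here  Px   = contradiction Px ¬Px
    ...   | there any′ = find-sound P? any′ d

    find-cong : ∀ {P Q : Pred (V Y) a} (P? : Unary.Decidable P) (Q? : Unary.Decidable Q) {xs} →
                (∀ x → P x ⇔ Q x) → Any P xs →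
                ∀ d e → fromMaybe d (find P? xs) ≡ fromMaybe e (find Q? xs)
    find-cong P? Q? {x ∷ xs} P⇔Q any d e with P? x | Q? x | any
    ... | yes Px | yes Qx | _          = refl
    ... | yes Px | no ¬Qx | _          = contradiction (Equivalence.to (P⇔Q x) Px) ¬Qx
    ... | no ¬Px | yes Qx | _          = contradiction (Equivalence.from (P⇔Q x) Qx) ¬Px
    ... | no ¬Px | no ¬Qx | here Px    = contradiction Px ¬Px
    ... | no ¬Px | no ¬Qx | there any′ = find-cong P? Q? P⇔Q any′ d e

    occurs : ∀ v → Any (SameOrbit v) Y.vertices
    occurs v = Any.map (λ { refl → same-refl }) (Y.enumerates v)

  same-first : ∀ v → SameOrbit v (first v)
  same-first v = find-sound (sameOrbit? v) (occurs v) v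

  first-cong : ∀ {v w} → SameOrbit v w → first v ≡ first w
  first-cong {v} {w} v~w = find-cong (sameOrbit? v) (sameOrbit? w)
    (λ x → mk⇔ (same-trans (same-sym v~w)) (same-trans v~w)) (occurs v) v w

  Orbit : Set
  Orbit = [ v ∈ V Y ∣ first v ≡ v ]

  orbit : V Y → Orbit
  orbit v = first v , [ sym (first-cong (same-first v)) ]

  orbit-≡⇔ : ∀ {v w} → orbit v ≡ orbit w ⇔ SameOrbit v w
  orbit-≡⇔ {v} {w} = mk⇔
    (λ eq → same-trans (same-first v) (same-sym (subst (SameOrbit w) (sym (cong value eq)) (same-first w))))
    (Refinement.value-injective ∘ first-cong)

  orbit-value : ∀ o → orbit (value o) ≡ o
  orbit-value (v , [ eq ]) = Refinement.value-injective (recompute (first v Y.≟ v) eq)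

  infix 4 _≟ᵒ_
  _≟ᵒ_ : DecidableEquality Orbit
  _≟ᵒ_ = Refinement._≟_ Y._≟_

  OrbitAdj : Rel Orbit 0ℓ
  OrbitAdj o o′ = ∃₂ λ v w → orbit v ≡ o × orbit w ≡ o′ × Adj Y v w

  private
    irrefl : Irreflexive _≡_ OrbitAdj
    irrefl refl (v , w , v∈o , w∈o , vw) = X.adj-irrefl
      (same⇒fibre (Equivalence.to orbit-≡⇔ (trans v∈o (sym w∈o)))) (P.map-adj vw)

  graph : Graph
  graph = record
    { V          = Orbit
    ; _≟_        = _≟ᵒ_
    ; vertices   = List.map orbit Y.vertices
    ; enumerates = λ o → subst (_∈ List.map orbit Y.vertices) (orbit-value o)
                           (∈-map⁺ orbit (Y.enumerates (value o)))
    ; Adj        = OrbitAdj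
    ; adj?       = λ o o′ → Y.any-vertex? λ v → Y.any-vertex? λ w →
                     orbit v ≟ᵒ o ×-dec orbit w ≟ᵒ o′ ×-dec Y.adj? v w
    ; adj-sym    = λ (v , w , v∈o , w∈o′ , vw) → w , v , w∈o′ , v∈o , Y.adj-sym vw
    ; adj-irrefl = irrefl
    }

record GaloisCover (Y X : Graph) (G : Group c ℓ) : Set (c ⊔ ℓ) where
  field
    cover    : Cover Y X
    action   : FibrewiseRegularAction cover G
    quotient : Quotient.graph action (whole G) ≅ X

infix 9 _/_
_/_ : {Y X : Graph} {G : Group c ℓ} → GaloisCover Y X G → DecSubgroup G p → Graph
p / H = Quotient.graph (GaloisCover.action p) H

-- Permutations compose as functions: (σ ∙ τ) i = σ (τ i).

𝔖 : ℕ → Group 0ℓ 0ℓ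
𝔖 n = record
  { Carrier = Permutation′ n
  ; _≈_     = Perm._≈_
  ; _∙_     = λ σ τ → τ ∘ₚ σ
  ; ε       = Perm.id
  ; _⁻¹     = Perm.flip
  ; isGroup = record
    { isMonoid = record
      { isSemigroup = record
        { isMagma = record
          { isEquivalence = record
            { refl  = λ _ → refl
            ; sym   = λ σ≈τ i → sym (σ≈τ i)
            ; trans = λ σ≈τ τ≈υ i → trans (σ≈τ i) (τ≈υ i)
            }
          ; ∙-cong = λ {σ} {σ′} {τ} {τ′} σ≈σ′ τ≈τ′ i →
              trans (cong (σ ⟨$⟩ʳ_) (τ≈τ′ i)) (σ≈σ′ (τ′ ⟨$⟩ʳ i))
          }
        ; assoc = λ _ _ _ _ → refl
        }
      ; identity = (λ _ _ → refl) , (λ _ _ → refl)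
      }
    ; inverse = (λ σ _ → Perm.inverseˡ σ) , (λ σ _ → Perm.inverseʳ σ)
    ; ⁻¹-cong = λ {σ} {τ} σ≈τ i → inv-cong {σ} {τ} σ≈τ i
    }
  }
  where
  inv-cong : ∀ {σ τ : Permutation′ n} → σ Perm.≈ τ → Perm.flip σ Perm.≈ Perm.flip τ
  inv-cong {σ} {τ} σ≈τ i = trans (cong (σ ⟨$⟩ˡ_) (trans (sym (Perm.inverseʳ τ)) (sym (σ≈τ (τ ⟨$⟩ˡ i)))))
    (Perm.inverseˡ σ)

data ⟨_⟩ {n} (s : Permutation′ n) : Pred (Permutation′ n) 0ℓ where
  generator : ⟨ s ⟩ s
  resp      : ∀ {σ τ} → σ Perm.≈ τ → ⟨ s ⟩ σ → ⟨ s ⟩ τ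
  ε-closed  : ⟨ s ⟩ Perm.id
  ∙-closed  : ∀ {σ τ} → ⟨ s ⟩ σ → ⟨ s ⟩ τ → ⟨ s ⟩ (τ ∘ₚ σ)
  ⁻¹-closed : ∀ {σ} → ⟨ s ⟩ σ → ⟨ s ⟩ (Perm.flip σ)

module _ {n : ℕ} where
  private
    infix 4 _≈?_ _∈ₚ_ _∈ₚ?_

    _≈?_ : Decidable (Perm._≈_ {n} {n})
    σ ≈? τ = Fin.all? λ i → (σ ⟨$⟩ʳ i) Fin.≟ (τ ⟨$⟩ʳ i)

    _∈ₚ_ : Permutation′ n → List (Permutation′ n) → Set
    σ ∈ₚ L = Any (σ Perm.≈_) L

    _∈ₚ?_ : Decidable _∈ₚ_
    σ ∈ₚ? L = Any.any? (σ ≈?_) L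

    Closed : Permutation′ n → List (Permutation′ n) → Set
    Closed s L = s ∈ₚ L × Perm.id ∈ₚ L ×
      All (λ σ → All (λ τ → (τ ∘ₚ σ) ∈ₚ L) L) L × All (λ σ → Perm.flip σ ∈ₚ L) L

  closed? : ∀ s L → Dec (Closed s L)
  closed? s L = s ∈ₚ? L ×-dec Perm.id ∈ₚ? L ×-dec
    All.all? (λ σ → All.all? (λ τ → (τ ∘ₚ σ) ∈ₚ? L) L) L ×-dec
    All.all? (λ σ → Perm.flip σ ∈ₚ? L) L

  cyclicSubgroup : (s : Permutation′ n) (L : List (Permutation′ n)) →
                   All ⟨ s ⟩ L → Closed s L → DecSubgroup (𝔖 n) 0ℓ
  cyclicSubgroup s L L⊆⟨s⟩ (s∈L , ε∈L , ∙∈L , ⁻¹∈L) = record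
    { member    = ⟨ s ⟩
    ; member?   = λ σ → Dec.map′ (sound σ) complete (σ ∈ₚ? L)
    ; resp      = λ {σ} {τ} → resp {σ = σ} {τ}
    ; ε-closed  = ε-closed
    ; ∙-closed  = ∙-closed
    ; ⁻¹-closed = ⁻¹-closed
    }
    where
    transport : ∀ σ τ → σ Perm.≈ τ → σ ∈ₚ L → τ ∈ₚ L
    transport _ _ σ≈τ = Any.map (λ σ≈υ i → trans (sym (σ≈τ i)) (σ≈υ i))

    lookup≈ : {P : Pred (Permutation′ n) 0ℓ} → (∀ σ τ → σ Perm.≈ τ → P σ → P τ) →
              All P L → ∀ σ → σ ∈ₚ L → P σ
    lookup≈ P-resp all σ σ∈L =
      All.lookupWith (λ {τ} Pτ σ≈τ → P-resp τ σ (λ i → sym (σ≈τ i)) Pτ) all σ∈L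

    sound : ∀ σ → σ ∈ₚ L → ⟨ s ⟩ σ
    sound = lookup≈ (λ σ τ → resp {σ = σ} {τ}) L⊆⟨s⟩

    complete : ∀ {σ} → ⟨ s ⟩ σ → σ ∈ₚ L
    complete generator                = s∈L
    complete (resp {σ} {τ} σ≈τ σ∈)    = transport σ τ σ≈τ (complete σ∈)
    complete ε-closed                 = ε∈L
    complete (∙-closed {σ} {τ} σ∈ τ∈) = lookup≈ {λ τ → (τ ∘ₚ σ) ∈ₚ L}
      (λ x y x≈y → transport (x ∘ₚ σ) (y ∘ₚ σ) (λ i → cong (σ ⟨$⟩ʳ_) (x≈y i)))
      (lookup≈ {λ σ → All (λ τ → (τ ∘ₚ σ) ∈ₚ L) L}
        (λ x y x≈y → All.map (λ {τ} → transport (τ ∘ₚ x) (τ ∘ₚ y) (λ i → x≈y (τ ⟨$⟩ʳ i))))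
        ∙∈L σ (complete σ∈))
      τ (complete τ∈)
    complete (⁻¹-closed {σ} σ∈)       = lookup≈ {λ σ → Perm.flip σ ∈ₚ L}
      (λ x y x≈y → transport (Perm.flip x) (Perm.flip y) (Group.⁻¹-cong (𝔖 n) {x} {y} x≈y))
      ⁻¹∈L σ (complete σ∈)

⦅12⦆ ⦅123⦆ : Permutation′ 3
⦅12⦆  = transpose 0F 1F
⦅123⦆ = permutation next prev (λ { 0F → refl ; 1F → refl ; 2F → refl })
                              (λ { 0F → refl ; 1F → refl ; 2F → refl })
  where
  next prev : Fin 3 → Fin 3
  next 0F = 1F
  next 1F = 2F
  next 2F = 0F
  prev 0F = 2F
  prev 1F = 0F
  prev 2F = 1F

C₂ C₃ : DecSubgroup (𝔖 3) 0ℓ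
C₂ = cyclicSubgroup ⦅12⦆ L (ε-closed ∷ generator ∷ []) (from-yes (closed? ⦅12⦆ L))
  where L = Perm.id ∷ ⦅12⦆ ∷ []
C₃ = cyclicSubgroup ⦅123⦆ L (ε-closed ∷ generator ∷ ∙-closed generator generator ∷ [])
       (from-yes (closed? ⦅123⦆ L))
  where L = Perm.id ∷ ⦅123⦆ ∷ ⦅123⦆ ∘ₚ ⦅123⦆ ∷ []

module _ {c′ ℓ′} {G : Group c ℓ} {K : Group c′ ℓ′} {φ : Group.Carrier G → Group.Carrier K} where
  private
    module G = Group G
    module K = Group K

  preimage : GroupMorphisms.IsGroupIsomorphism G.rawGroup K.rawGroup φ → DecSubgroup K p → DecSubgroup G p
  preimage iso H = record
    { member    = H.member ∘ φ
    ; member?   = H.member? ∘ φ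
    ; resp      = H.resp ∘ ⟦⟧-cong
    ; ε-closed  = H.resp (K.sym ε-homo) H.ε-closed
    ; ∙-closed  = λ {g} {h} g∈ h∈ → H.resp (K.sym (homo g h)) (H.∙-closed g∈ h∈)
    ; ⁻¹-closed = λ {g} g∈ → H.resp (K.sym (⁻¹-homo g)) (H.⁻¹-closed g∈)
    }
    where
    module H = DecSubgroup H
    open GroupMorphisms.IsGroupIsomorphism iso using (isGroupHomomorphism)
    open GroupMorphisms.IsGroupHomomorphism isGroupHomomorphism

{-# OPTIONS --safe #-}

-- Both sides have constant term 1, so it is enough to compare logarithmic
-- derivatives. Every reduced closed walk is a power of a rotation of a unique
-- prime representative, so u·ζ′/ζ is the generating function of the numbers
-- N(m) of reduced closed walks of length m. If a group H acts on Y by deck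
-- transformations with quotient Z, unique path lifting gives
-- |H| · N_Z(m) = Σ_{h ∈ H} a(h), where a(h) counts the reduced walks s in Y
-- with s(m + i) = h · s(i). As a is a class function on 𝔖₃, the four counts
-- are combinations of its values at 1, (1 2 3) and (1 2), and
-- N_Y + 2 N_X = N_Q + 2 N_T; this is the identity
-- Ind₁ 1 + 2 · 1 = Ind_{C₃} 1 + 2 · Ind_{C₂} 1 of permutation characters.

module Submission where

open import Algebra.Bundles using (CommutativeRing; Group)
import Algebra.Construct.Pointwise as Pointwise
open import Algebra.Morphism.Structures using (module GroupMorphisms)
import Algebra.Properties.CommutativeSemigroup as CommutativeSemigroupProperties
import Algebra.Properties.Group as GroupProperties
import Algebra.Properties.Semiring.Sum as Sum
open import Data.Bool.Base using (true; false; if_then_else_)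
open import Data.Fin.Base using (Fin; zero; suc; toℕ; fromℕ<)
open import Data.Fin.Patterns using (0F; 1F; 2F; 3F; 4F; 5F)
import Data.Fin.Permutation as Perm
open Perm using (Permutation′; _⟨$⟩ʳ_; _⟨$⟩ˡ_; _∘ₚ_)
import Data.Fin.Properties as Fin
open import Data.Integer.Base as ℤ using (ℤ; +_; 0ℤ; 1ℤ)
import Data.Integer.Properties as ℤ
import Data.Integer.Tactic.RingSolver as ℤ-Solver
open import Data.Irrelevant using ([_])
open import Data.List.Base as List
  using (List; []; _∷_; _++_; _∷ʳ_; length; take; drop; lookup; concat; tabulate; allFin; applyUpTo;
         concatMap; filter; deduplicate; cartesianProduct)
open import Data.List.Membership.Propositional using (_∈_)
open import Data.List.Membership.Propositional.Properties
  using (∈-filter⁺; ∈-filter⁻; ∈-deduplicate⁻; ∈-lookup; ∈-allFin; ∈-cartesianProduct⁺;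
         ∈-cartesianProductWith⁺; ∈-cartesianProductWith⁻)
import Data.List.Membership.Setoid as Membership
import Data.List.Properties as List
open import Data.List.Relation.Unary.All as All using (All; []; _∷_)
import Data.List.Relation.Unary.All.Properties as All
open import Data.List.Relation.Unary.AllPairs using (AllPairs; []; _∷_)
import Data.List.Relation.Unary.AllPairs.Properties as AllPairs
open import Data.List.Relation.Unary.Any as Any using (Any; here; there)
import Data.List.Relation.Unary.Any.Properties as Any
open import Data.List.Relation.Unary.Enumerates.Setoid using (IsEnumeration)
import Data.List.Relation.Unary.Enumerates.Setoid.Properties as Enumerates
open import Data.List.Relation.Unary.Linked using (Linked; []; _∷_)
import Data.List.Relation.Unary.Linked.Properties as Linked
import Data.List.Relation.Unary.Unique.Propositional.Properties as UniqueProp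
open import Data.List.Relation.Unary.Unique.Setoid using (Unique)
import Data.List.Relation.Unary.Unique.Setoid.Properties as Unique
import Data.Maybe.Base as Maybe
import Data.Maybe.Relation.Unary.Any as MaybeAny
open import Data.Nat.Base as ℕ
  using (ℕ; zero; suc; _+_; _*_; _∸_; _≤_; _<_; z≤n; s≤s; z<s; s<s; NonZero)
open import Data.Nat.Divisibility using (_∣_; _∣?_; divides; ∣-refl; ∣-trans; ∣-antisym; ∣⇒≤)
open import Data.Nat.DivMod
  using (_%_; m≡m%n+[m/n]*n; m%n<n; m<n⇒m%n≡m; [m+n]%n≡m%n) renaming (_/_ to _div_)
open import Data.Nat.GCD using (gcd; gcd[m,n]∣m; gcd[m,n]∣n; gcd-GCD; module Bézout)
open import Data.Nat.Induction using (<-wellFounded)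
import Data.Nat.ListAction as ListAction
import Data.Nat.Properties as ℕ
import Data.Nat.Tactic.RingSolver as ℕ-Solver
open import Data.Product.Base using (Σ; ∃; ∃₂; _×_; _,_; proj₁; proj₂)
open import Data.Product.Relation.Binary.Pointwise.NonDependent using (_×ₛ_)
open import Data.Refinement as Refinement using (value)
open import Data.Sum.Base using (inj₁; inj₂)
open import Function.Base using (_∘_; id)
open import Function.Bundles using (Equivalence)
open import Induction.WellFounded using (Acc; acc)
open import Level using (Level; 0ℓ; _⊔_)
open import Relation.Binary.Bundles using (Setoid)
open import Relation.Binary.Core using (Rel)
open import Relation.Binary.Definitions using (Decidable)
open import Relation.Binary.PropositionalEquality
  using (_≡_; _≢_; _≗_; refl; sym; trans; cong; cong₂; subst; subst₂; setoid; module ≡-Reasoning)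
import Relation.Binary.Reasoning.Setoid as ≈-Reasoning
open import Relation.Nullary using (¬_; Dec; does; yes; no; recompute; contradiction)
open import Relation.Nullary.Decidable as Dec
  using (True; toWitness; from-yes; dec-false; dec⇒maybe; ¬?; _×-dec_; _→-dec_)
open import Relation.Unary using (Pred)
open import Defs

open Graph using (V; Adj)

-- Periodic sequences on all of ℕ replace closed walks because indices then never need reduction,
-- the cyclic conditions become conditions at every index, and path lifting is plain recursion on
-- the index. The price is that equality is pointwise, so every count is the size of a
-- duplicate-free enumeration of a setoid. The formula |H| · N_Z(m) = Σ a(h) counts one set twice:
-- the lifts to Y of the closed walks of Z. Sorted by starting point there are |H| of them over each
-- closed walk; sorted by the element carrying s(0) to s(m) they split into the twisted walks of the
-- various h. Coefficient n of `ζ` is read off a product that itself depends on n, so `ζ` is not one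
-- product to be differentiated. Logarithmic derivatives are therefore compared only up to a given
-- degree. There they determine the integer coefficients, since multiplication by a positive integer
-- is injective on ℤ.

private
  variable
    a b c ℓ ℓ′ p q r : Level
    A : Set a

-- The ring of formal power series and logarithmic derivatives

open Sum ℤ.+-*-semiring using (sum; sum-cong-≗; ∑-distrib-+; *-distribˡ-sum)

infixl 6 _⊕_
_⊕_ : PowerSeries → PowerSeries → PowerSeries
(f ⊕ g) n = f n ℤ.+ g n

tail : PowerSeries → PowerSeries
tail f n = f (suc n)

scale : ℤ → PowerSeries → PowerSeries
scale a f n = a ℤ.* f n

⊛-cong-≤ : ∀ {f f′ g g′} n → (∀ i → i ≤ n → f i ≡ f′ i) → (∀ i → i ≤ n → g i ≡ g′ i) →
           (f ⊛ g) n ≡ (f′ ⊛ g′) n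
⊛-cong-≤ n f≡f′ g≡g′ = sum-cong-≗ {suc n} λ i →
  cong₂ ℤ._*_ (f≡f′ (toℕ i) (Fin.toℕ≤pred[n] i)) (g≡g′ (n ∸ toℕ i) (ℕ.m∸n≤m n (toℕ i)))

⊛-cong : ∀ {f f′ g g′} → f ≋ f′ → g ≋ g′ → f ⊛ g ≋ f′ ⊛ g′
⊛-cong f≋f′ g≋g′ n = ⊛-cong-≤ n (λ i _ → f≋f′ i) (λ i _ → g≋g′ i)

⊛-distribˡ : ∀ f g h → f ⊛ (g ⊕ h) ≋ f ⊛ g ⊕ f ⊛ h
⊛-distribˡ f g h n = trans
  (sum-cong-≗ {suc n} λ i → ℤ.*-distribˡ-+ (f (toℕ i)) (g (n ∸ toℕ i)) (h (n ∸ toℕ i)))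
  (∑-distrib-+ {suc n} (λ i → f (toℕ i) ℤ.* g (n ∸ toℕ i)) (λ i → f (toℕ i) ℤ.* h (n ∸ toℕ i)))

⊛-distribʳ : ∀ f g h → (g ⊕ h) ⊛ f ≋ g ⊛ f ⊕ h ⊛ f
⊛-distribʳ f g h n = trans
  (sum-cong-≗ {suc n} λ i → ℤ.*-distribʳ-+ (f (n ∸ toℕ i)) (g (toℕ i)) (h (toℕ i)))
  (∑-distrib-+ {suc n} (λ i → g (toℕ i) ℤ.* f (n ∸ toℕ i)) (λ i → h (toℕ i) ℤ.* f (n ∸ toℕ i)))

scale-⊛ : ∀ a f g → scale a f ⊛ g ≋ scale a (f ⊛ g)
scale-⊛ a f g n = trans
  (sum-cong-≗ {suc n} λ i → ℤ.*-assoc a (f (toℕ i)) (g (n ∸ toℕ i)))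
  (sym (*-distribˡ-sum {suc n} a (λ i → f (toℕ i) ℤ.* g (n ∸ toℕ i))))

-- By computation the sum splits at f 0, with `tail f` remaining. This is the mirror image for the
-- right factor; the two together make commutativity an induction.
⊛-sucʳ : ∀ f g n → (f ⊛ g) (suc n) ≡ f (suc n) ℤ.* g 0 ℤ.+ (f ⊛ tail g) n
⊛-sucʳ f g zero    = lemma (f 0) (f 1) (g 0) (g 1)
  where
  lemma : ∀ a b c d → a ℤ.* d ℤ.+ (b ℤ.* c ℤ.+ 0ℤ) ≡ b ℤ.* c ℤ.+ (a ℤ.* d ℤ.+ 0ℤ)
  lemma = ℤ-Solver.solve-∀
⊛-sucʳ f g (suc n) = trans
  (cong (λ x → f 0 ℤ.* g (suc (suc n)) ℤ.+ x) (⊛-sucʳ (tail f) g n))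
  (lemma (f 0 ℤ.* g (suc (suc n))) (f (suc (suc n)) ℤ.* g 0) ((tail f ⊛ tail g) n))
  where
  lemma : ∀ a b c → a ℤ.+ (b ℤ.+ c) ≡ b ℤ.+ (a ℤ.+ c)
  lemma = ℤ-Solver.solve-∀

⊛-comm : ∀ f g → f ⊛ g ≋ g ⊛ f
⊛-comm f g zero    = cong (ℤ._+ 0ℤ) (ℤ.*-comm (f 0) (g 0))
⊛-comm f g (suc n) = trans
  (cong₂ ℤ._+_ (ℤ.*-comm (f 0) (g (suc n))) (⊛-comm (tail f) g n))
  (sym (⊛-sucʳ g f n))

⊛-assoc : ∀ f g h → (f ⊛ g) ⊛ h ≋ f ⊛ (g ⊛ h)
⊛-assoc f g h zero    = lemma (f 0) (g 0) (h 0)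
  where
  lemma : ∀ a b c → (a ℤ.* b ℤ.+ 0ℤ) ℤ.* c ℤ.+ 0ℤ ≡ a ℤ.* (b ℤ.* c ℤ.+ 0ℤ) ℤ.+ 0ℤ
  lemma = ℤ-Solver.solve-∀
⊛-assoc f g h (suc n) = begin
  (f ⊛ g) 0 ℤ.* h (suc n) ℤ.+ ((scale (f 0) (tail g) ⊕ tail f ⊛ g) ⊛ h) n
    ≡⟨ cong (λ x → (f ⊛ g) 0 ℤ.* h (suc n) ℤ.+ x)
         (trans (⊛-distribʳ h (scale (f 0) (tail g)) (tail f ⊛ g) n)
           (cong₂ ℤ._+_ (scale-⊛ (f 0) (tail g) h n) (⊛-assoc (tail f) g h n))) ⟩
  (f 0 ℤ.* g 0 ℤ.+ 0ℤ) ℤ.* h (suc n) ℤ.+ (f 0 ℤ.* (tail g ⊛ h) n ℤ.+ (tail f ⊛ (g ⊛ h)) n)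
    ≡⟨ lemma (f 0) (g 0) (h (suc n)) ((tail g ⊛ h) n) ((tail f ⊛ (g ⊛ h)) n) ⟩
  f 0 ℤ.* (g 0 ℤ.* h (suc n) ℤ.+ (tail g ⊛ h) n) ℤ.+ (tail f ⊛ (g ⊛ h)) n ∎
  where
  open ≡-Reasoning
  lemma : ∀ a b c d e → (a ℤ.* b ℤ.+ 0ℤ) ℤ.* c ℤ.+ (a ℤ.* d ℤ.+ e) ≡ a ℤ.* (b ℤ.* c ℤ.+ d) ℤ.+ e
  lemma = ℤ-Solver.solve-∀

⊛-identityˡ : ∀ f → 𝟙 ⊛ f ≋ f
⊛-identityˡ f zero    = trans (ℤ.+-identityʳ _) (ℤ.*-identityˡ (f 0))
⊛-identityˡ f (suc n) = trans
  (cong₂ ℤ._+_ (ℤ.*-identityˡ (f (suc n))) (scale-⊛ 0ℤ 𝟙 f n))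
  (ℤ.+-identityʳ (f (suc n)))

powerSeriesRing : CommutativeRing _ _
powerSeriesRing = record
  { Carrier = PowerSeries
  ; _≈_ = _≋_
  ; _+_ = _⊕_
  ; _*_ = _⊛_
  ; -_  = λ f n → ℤ.- f n
  ; 0#  = λ _ → 0ℤ
  ; 1#  = 𝟙
  ; isCommutativeRing = record
    { isRing = record
      { +-isAbelianGroup = Pointwise.isAbelianGroup ℕ ℤ.+-0-isAbelianGroup
      ; *-cong = ⊛-cong
      ; *-assoc = ⊛-assoc
      ; *-identity = ⊛-identityˡ , λ f n → trans (⊛-comm f 𝟙 n) (⊛-identityˡ f n)
      ; distrib = ⊛-distribˡ , ⊛-distribʳ
      }
    ; *-comm = ⊛-comm
    }
  }

open CommutativeRing powerSeriesRing using ()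
  renaming (setoid to ≋-setoid; sym to ≋-sym; trans to ≋-trans)

open CommutativeSemigroupProperties (CommutativeRing.*-commutativeSemigroup powerSeriesRing)
  using (x∙yz≈y∙xz)

-- The derivation u·d/du.

θ : PowerSeries → PowerSeries
θ f n = + n ℤ.* f n

θ-cong : ∀ {f g} → f ≋ g → θ f ≋ θ g
θ-cong f≋g n = cong (+ n ℤ.*_) (f≋g n)

θ-⊛ : ∀ f g → θ (f ⊛ g) ≋ θ f ⊛ g ⊕ f ⊛ θ g
θ-⊛ f g n = begin
  + n ℤ.* (f ⊛ g) n
    ≡⟨ *-distribˡ-sum {suc n} (+ n) (λ i → f (toℕ i) ℤ.* g (n ∸ toℕ i)) ⟩
  sum {suc n} (λ i → + n ℤ.* (f (toℕ i) ℤ.* g (n ∸ toℕ i)))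
    ≡⟨ sum-cong-≗ {suc n} (λ i → leibniz (toℕ i) (Fin.toℕ≤pred[n] i)) ⟩
  sum {suc n} (λ i → θ f (toℕ i) ℤ.* g (n ∸ toℕ i) ℤ.+ f (toℕ i) ℤ.* θ g (n ∸ toℕ i))
    ≡⟨ ∑-distrib-+ {suc n} (λ i → θ f (toℕ i) ℤ.* g (n ∸ toℕ i)) (λ i → f (toℕ i) ℤ.* θ g (n ∸ toℕ i)) ⟩
  (θ f ⊛ g ⊕ f ⊛ θ g) n ∎
  where
  open ≡-Reasoning
  lemma : ∀ i j a b → (i ℤ.+ j) ℤ.* (a ℤ.* b) ≡ (i ℤ.* a) ℤ.* b ℤ.+ a ℤ.* (j ℤ.* b)
  lemma = ℤ-Solver.solve-∀
  leibniz : ∀ i → i ≤ n → + n ℤ.* (f i ℤ.* g (n ∸ i)) ≡ θ f i ℤ.* g (n ∸ i) ℤ.+ f i ℤ.* θ g (n ∸ i)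
  leibniz i i≤n = trans
    (cong (λ m → + m ℤ.* (f i ℤ.* g (n ∸ i))) (sym (ℕ.m+[n∸m]≡n i≤n)))
    (trans (cong (ℤ._* (f i ℤ.* g (n ∸ i))) (ℤ.pos-+ i (n ∸ i)))
      (lemma (+ i) (+ (n ∸ i)) (f i) (g (n ∸ i))))

-- Expresses M = u f′/f without dividing by f.
IsLogDerivative : PowerSeries → PowerSeries → Set
IsLogDerivative M f = θ f ≋ M ⊛ f

logDerivative-⊛ : ∀ {M f K g} → IsLogDerivative M f → IsLogDerivative K g →
                  IsLogDerivative (M ⊕ K) (f ⊛ g)
logDerivative-⊛ {M} {f} {K} {g} θf≋Mf θg≋Kg = begin
  θ (f ⊛ g)                   ≈⟨ θ-⊛ f g ⟩
  θ f ⊛ g ⊕ f ⊛ θ g           ≈⟨ (λ n → cong₂ ℤ._+_ (⊛-cong {g = g} θf≋Mf (λ _ → refl) n)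
                                           (⊛-cong {f = f} (λ _ → refl) θg≋Kg n)) ⟩
  (M ⊛ f) ⊛ g ⊕ f ⊛ (K ⊛ g)   ≈⟨ (λ n → cong₂ ℤ._+_ (⊛-assoc M f g n) (x∙yz≈y∙xz f K g n)) ⟩
  M ⊛ (f ⊛ g) ⊕ K ⊛ (f ⊛ g)   ≈⟨ ≋-sym (⊛-distribʳ (f ⊛ g) M K) ⟩
  (M ⊕ K) ⊛ (f ⊛ g)           ∎
  where open ≈-Reasoning ≋-setoid

-- As `M 0` vanishes, coefficient m + 1 of `M ⊛ f` involves only f 0, ..., f m. The equation thus
-- determines (m + 1) · f (m + 1), and m + 1 cancels in ℤ. The hypotheses stop at degree n so that
-- truncated products can be compared.
logDerivative-unique : ∀ {M K f g} n → M 0 ≡ 0ℤ → f 0 ≡ g 0 → (∀ i → i ≤ n → M i ≡ K i) →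
  (∀ i → i ≤ n → θ f i ≡ (M ⊛ f) i) → (∀ i → i ≤ n → θ g i ≡ (K ⊛ g) i) → f n ≡ g n
logDerivative-unique {M} {K} {f} {g} n M₀ f₀≡g₀ M≡K Lf Lg = agree n n ℕ.≤-refl ℕ.≤-refl
  where
  K₀ : K 0 ≡ 0ℤ
  K₀ = trans (sym (M≡K 0 z≤n)) M₀
  drop₀ : ∀ M f m → M 0 ≡ 0ℤ → (M ⊛ f) (suc m) ≡ (tail M ⊛ f) m
  drop₀ M f m M₀ = trans (cong (λ x → x ℤ.* f (suc m) ℤ.+ (tail M ⊛ f) m) M₀) (ℤ.+-identityˡ _)
  -- The bound `b` makes the strong induction on m structural.
  agree : ∀ b m → m ≤ b → b ≤ n → f m ≡ g m
  agree b       zero    _         _   = f₀≡g₀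
  agree (suc b) (suc m) (s≤s m≤b) b≤n = ℤ.*-cancelˡ-≡ (+ suc m) _ _
    (trans (Lf (suc m) m≤n) (trans (drop₀ M f m M₀)
      (trans (⊛-cong-≤ {tail M} {tail K} m (λ i i≤m → M≡K (suc i) (ℕ.≤-trans (s≤s i≤m) m≤n))
                         (λ i i≤m → agree b i (ℕ.≤-trans i≤m m≤b) (ℕ.<⇒≤ b≤n)))
        (trans (sym (drop₀ K g m K₀)) (sym (Lg (suc m) m≤n))))))
    where m≤n = ℕ.≤-trans (s≤s m≤b) b≤n

-- The coefficients of the logarithmic derivative of ∏ (1 - uᵏ)⁻¹ over k in ks.

powerSum : List ℕ → ℕ → ℕ
powerSum ks zero    = 0
powerSum ks (suc n) = ListAction.sum (List.map (λ k → if does (k ∣? suc n) then k else 0) ks)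

geometric-zero : ∀ k .{{_ : NonZero k}} → geometric k 0 ≡ 1ℤ
geometric-zero (suc k) = refl

private
  -- Applying `θ` to f · g = 1, where f = 1 - uᵏ, gives f · θg = -θf · g = k uᵏ g. Multiplication by
  -- g = f⁻¹ yields θg = (k uᵏ g) · g, and uᵏ g = (1 - f) g = g - 1.
  geometric-logDerivative′ : ∀ k .{{_ : NonZero k}} →
    IsLogDerivative (scale (+ k) (geometric k ⊖ 𝟙)) (geometric k)
  geometric-logDerivative′ k = begin
    θ g                            ≈⟨ ≋-sym (⊛-identityˡ (θ g)) ⟩
    𝟙 ⊛ θ g                        ≈⟨ ⊛-cong {g = θ g} (≋-sym inverse) (λ _ → refl) ⟩
    (f ⊛ g) ⊛ θ g                  ≈⟨ ≋-trans (⊛-assoc f g (θ g)) (x∙yz≈y∙xz f g (θ g)) ⟩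
    g ⊛ (f ⊛ θ g)                  ≈⟨ ⊛-cong {f = g} (λ _ → refl) fθg ⟩
    g ⊛ (scale (+ k) (𝟙 ⊖ f) ⊛ g)  ≈⟨ ⊛-comm g (scale (+ k) (𝟙 ⊖ f) ⊛ g) ⟩
    (scale (+ k) (𝟙 ⊖ f) ⊛ g) ⊛ g  ≈⟨ ⊛-cong {g = g} factor (λ _ → refl) ⟩
    scale (+ k) (g ⊖ 𝟙) ⊛ g        ∎
    where
    open ≈-Reasoning ≋-setoid
    f g : PowerSeries
    f = 𝟙 ⊖ u^ k
    g = geometric k
    inverse : f ⊛ g ≋ 𝟙
    inverse = geometric-inverse k
    1-f : 𝟙 ⊖ f ≋ u^ k
    1-f n = lemma (𝟙 n) ((u^ k) n)
      where
      lemma : ∀ a b → a ℤ.- (a ℤ.- b) ≡ b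
      lemma = ℤ-Solver.solve-∀
    θf : θ f ≋ λ n → ℤ.- scale (+ k) (𝟙 ⊖ f) n
    θf zero    = sym (cong ℤ.-_ (trans (cong (+ k ℤ.*_) (1-f 0)) (k·u⁰ k)))
      where
      k·u⁰ : ∀ k → + k ℤ.* (u^ k) 0 ≡ 0ℤ
      k·u⁰ zero    = refl
      k·u⁰ (suc k) = ℤ.*-zeroʳ (+ suc k)
    θf (suc n) = trans (cong (+ suc n ℤ.*_) (ℤ.+-identityˡ (ℤ.- (u^ k) (suc n))))
      (trans (sym (ℤ.neg-distribʳ-* (+ suc n) ((u^ k) (suc n))))
        (cong ℤ.-_ (trans n·uᵏ (cong (+ k ℤ.*_) (sym (1-f (suc n)))))))
      where
      n·uᵏ : + suc n ℤ.* (u^ k) (suc n) ≡ + k ℤ.* (u^ k) (suc n)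
      n·uᵏ with k ℕ.≟ suc n
      ... | yes refl = refl
      ... | no  k≢   = trans (cong (+ suc n ℤ.*_) u≡0) (trans (ℤ.*-zeroʳ (+ suc n))
        (sym (trans (cong (+ k ℤ.*_) u≡0) (ℤ.*-zeroʳ (+ k)))))
        where
        u≡0 : (u^ k) (suc n) ≡ 0ℤ
        u≡0 = cong (if_then 1ℤ else 0ℤ) (dec-false (k ℕ.≟ suc n) k≢)
    θ𝟙 : ∀ n → θ 𝟙 n ≡ 0ℤ
    θ𝟙 zero    = refl
    θ𝟙 (suc n) = ℤ.*-zeroʳ (+ suc n)
    fθg : f ⊛ θ g ≋ scale (+ k) (𝟙 ⊖ f) ⊛ g
    fθg n = trans (move ((θ f ⊛ g) n) ((f ⊛ θ g) n)
              (trans (sym (θ-⊛ f g n)) (trans (θ-cong inverse n) (θ𝟙 n))))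
            (neg n)
      where
      lemma : ∀ a b → b ≡ (a ℤ.+ b) ℤ.+ ℤ.- a
      lemma = ℤ-Solver.solve-∀
      move : ∀ a b → a ℤ.+ b ≡ 0ℤ → b ≡ ℤ.- a
      move a b a+b≡0 = trans (lemma a b) (trans (cong (ℤ._+ ℤ.- a) a+b≡0) (ℤ.+-identityˡ _))
      neg : ∀ n → ℤ.- (θ f ⊛ g) n ≡ (scale (+ k) (𝟙 ⊖ f) ⊛ g) n
      neg n = trans (cong ℤ.-_ (trans
        (⊛-cong {g = g} (λ i → trans (θf i) (sym (ℤ.-1*i≡-i _))) (λ _ → refl) n)
        (trans (scale-⊛ (ℤ.- 1ℤ) (scale (+ k) (𝟙 ⊖ f)) g n) (ℤ.-1*i≡-i _)))) (ℤ.neg-involutive _)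
    factor : scale (+ k) (𝟙 ⊖ f) ⊛ g ≋ scale (+ k) (g ⊖ 𝟙)
    factor n = trans (scale-⊛ (+ k) (𝟙 ⊖ f) g n) (cong (+ k ℤ.*_) (trans
      (⊛-distribʳ g 𝟙 (λ i → ℤ.- f i) n)
      (cong₂ ℤ._+_ (⊛-identityˡ g n) (trans
        (⊛-cong {g = g} (λ i → sym (ℤ.-1*i≡-i (f i))) (λ _ → refl) n)
        (trans (scale-⊛ (ℤ.- 1ℤ) f g n) (trans (ℤ.-1*i≡-i _) (cong ℤ.-_ (inverse n))))))))

-- For n > 0, coefficient n of k (g - 1) is k if k divides n and 0 otherwise. At degree 0 the
-- constant terms cancel, which is why `powerSum` vanishes there although k divides 0.
geometric-logDerivative : ∀ k .{{_ : NonZero k}} →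
  IsLogDerivative (+_ ∘ powerSum (k ∷ [])) (geometric k)
geometric-logDerivative k n = trans (geometric-logDerivative′ k n)
  (⊛-cong {g = geometric k} coefficient (λ _ → refl) n)
  where
  coefficient : scale (+ k) (geometric k ⊖ 𝟙) ≋ +_ ∘ powerSum (k ∷ [])
  coefficient zero = trans (cong (λ x → + k ℤ.* (x ℤ.- 1ℤ)) (geometric-zero k)) (ℤ.*-zeroʳ (+ k))
  coefficient (suc n) with does (k ∣? suc n)
  ... | true  = trans (ℤ.*-identityʳ (+ k)) (cong +_ (sym (ℕ.+-identityʳ k)))
  ... | false = ℤ.*-zeroʳ (+ k)

∏-geometric-logDerivative : ∀ {ks} → All NonZero ks →
  IsLogDerivative (+_ ∘ powerSum ks) (∏ (List.map geometric ks))
∏-geometric-logDerivative [] zero = refl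
∏-geometric-logDerivative [] (suc n) =
  trans (ℤ.*-zeroʳ (+ suc n)) (sym (trans (⊛-cong {g = 𝟙} zeros (λ _ → refl) (suc n)) (scale-⊛ 0ℤ 𝟙 𝟙 (suc n))))
  where
  zeros : +_ ∘ powerSum [] ≋ scale 0ℤ 𝟙
  zeros zero    = refl
  zeros (suc n) = refl
∏-geometric-logDerivative {k ∷ ks} (k≢0 ∷ ks≢0) n = trans
  (logDerivative-⊛ {M = +_ ∘ powerSum (k ∷ [])} {K = +_ ∘ powerSum ks}
    (geometric-logDerivative k {{k≢0}}) (∏-geometric-logDerivative ks≢0) n)
  (⊛-cong {g = ∏ (List.map geometric (k ∷ ks))} split (λ _ → refl) n)
  where
  split : (+_ ∘ powerSum (k ∷ [])) ⊕ (+_ ∘ powerSum ks) ≋ +_ ∘ powerSum (k ∷ ks)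
  split zero    = refl
  split (suc n) = trans (sym (ℤ.pos-+ (powerSum (k ∷ []) (suc n)) (powerSum ks (suc n))))
    (cong (λ x → + (x ℕ.+ powerSum ks (suc n))) (ℕ.+-identityʳ _))

∏-geometric-zero : ∀ {ks} → All NonZero ks → ∏ (List.map geometric ks) 0 ≡ 1ℤ
∏-geometric-zero [] = refl
∏-geometric-zero {k ∷ ks} (k≢0 ∷ ks≢0) = cong₂ (λ x y → x ℤ.* y ℤ.+ 0ℤ)
  (geometric-zero k {{k≢0}}) (∏-geometric-zero ks≢0)

-- Words and periodic sequences

-- A word of length n is the window of an n-periodic sequence. Powers of a
-- word have the same sequence, and rotations shift it.

module _ {A : Set a} where

  Periodic : ℕ → (ℕ → A) → Set a
  Periodic n s = ∀ i → s (n + i) ≡ s i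

  shift : ℕ → (ℕ → A) → ℕ → A
  shift k s i = s (k + i)

  periodic-cong : ∀ {n s t} → s ≗ t → Periodic n s → Periodic n t
  periodic-cong {n} s≗t ps i = trans (sym (s≗t (n + i))) (trans (ps i) (s≗t i))

  periodic-* : ∀ {n s} → Periodic n s → ∀ k → Periodic (k * n) s
  periodic-*         ps zero    i = refl
  periodic-* {n} {s} ps (suc k) i =
    trans (cong s (ℕ.+-assoc n (k * n) i)) (trans (ps (k * n + i)) (periodic-* {n} {s} ps k i))

  periodic-∣ : ∀ {m n s} → m ∣ n → Periodic m s → Periodic n s
  periodic-∣ {s = s} (divides k refl) ps = periodic-* {s = s} ps k

  -- If d + y n = x m for the gcd d, then s(d + i) = s(d + y n + i) = s(x m + i) = s(i). The other
  -- sign in Bézout's identity exchanges m and n.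
  periodic-gcd : ∀ {m n s} → Periodic m s → Periodic n s → Periodic (gcd m n) s
  periodic-gcd {m} {n} {s} pm pn i with Bézout.identity (gcd-GCD m n)
  ... | Bézout.+- x y eq = trans (sym (periodic-* {n} {s} pn y (gcd m n + i)))
    (trans (cong s (trans (sym (ℕ.+-assoc (y * n) (gcd m n) i))
      (cong (_+ i) (trans (ℕ.+-comm (y * n) (gcd m n)) eq)))) (periodic-* {m} {s} pm x i))
  ... | Bézout.-+ x y eq = trans (sym (periodic-* {m} {s} pm x (gcd m n + i)))
    (trans (cong s (trans (sym (ℕ.+-assoc (x * m) (gcd m n) i))
      (cong (_+ i) (trans (ℕ.+-comm (x * m) (gcd m n)) eq)))) (periodic-* {n} {s} pn y i))

  periodic-shift : ∀ {n s} k → Periodic n s → Periodic n (shift k s)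
  periodic-shift {n} {s} k ps i = trans (cong s lemma) (ps (k + i))
    where
    lemma : k + (n + i) ≡ n + (k + i)
    lemma = trans (sym (ℕ.+-assoc k n i)) (trans (cong (_+ i) (ℕ.+-comm k n)) (ℕ.+-assoc n k i))

  -- Undoes a shift without subtraction: for period n the index j = k (n - 1) + i satisfies k + j =
  -- k n + i. One j serves every offset p, so periods of the shifted sequence carry back to `s`.
  unshift : ∀ {n s} .{{_ : NonZero n}} → Periodic n s → ∀ k i → ∃ λ j → ∀ p → s (p + i) ≡ shift k s (p + j)
  unshift {suc n} {s} ps k i = k * n + i , λ p → trans (sym (periodic-* {suc n} {s} ps k (p + i))) (cong s (eq p))
    where
    open ≡-Reasoning
    eq : ∀ p → k * suc n + (p + i) ≡ k + (p + (k * n + i))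
    eq p = begin
      k * suc n + (p + i)    ≡⟨ cong (_+ (p + i)) (ℕ.*-suc k n) ⟩
      k + k * n + (p + i)    ≡⟨ ℕ.+-assoc k (k * n) (p + i) ⟩
      k + (k * n + (p + i))  ≡⟨ cong (ℕ._+_ k) (ℕ.+-assoc (k * n) p i) ⟨
      k + (k * n + p + i)    ≡⟨ cong (λ x → k + (x + i)) (ℕ.+-comm (k * n) p) ⟩
      k + (p + k * n + i)    ≡⟨ cong (ℕ._+_ k) (ℕ.+-assoc p (k * n) i) ⟩
      k + (p + (k * n + i))  ∎

  periodic-unshift : ∀ {n p s} .{{_ : NonZero n}} k → Periodic n s →
                     Periodic p (shift k s) → Periodic p s
  periodic-unshift {n} {p} {s} k ps pk i with j , eq ← unshift {n} {s} ps k i =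
    trans (eq p) (trans (pk j) (sym (eq 0)))

  periodic-% : ∀ {n s} .{{_ : NonZero n}} → Periodic n s → ∀ i → s i ≡ s (i % n)
  periodic-% {n} {s} ps i = trans
    (cong s (trans (m≡m%n+[m/n]*n i n) (ℕ.+-comm (i % n) (i div n * n))))
    (periodic-* {n} {s} ps (i div n) (i % n))

  shift-% : ∀ {n s} .{{_ : NonZero n}} → Periodic n s → ∀ k → shift k s ≗ shift (k % n) s
  shift-% {n} {s} ps k i = trans (cong s (ℕ.+-comm k i)) (trans (periodic-% {n} {shift i s}
    (periodic-shift {n} {s} i ps) k) (cong s (ℕ.+-comm i (k % n))))

  window : (ℕ → A) → ℕ → List A
  window = applyUpTo

  length-window : ∀ s n → length (window s n) ≡ n
  length-window = List.length-applyUpTo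

  window-cong : ∀ {s t} n → (∀ i → i < n → s i ≡ t i) → window s n ≡ window t n
  window-cong zero    eq = refl
  window-cong (suc n) eq = cong₂ _∷_ (eq 0 z<s) (window-cong n λ i i<n → eq (suc i) (s<s i<n))

  window-injective : ∀ {s t} n → window s n ≡ window t n → ∀ i → i < n → s i ≡ t i
  window-injective (suc n) eq zero    _         = List.∷-injectiveˡ eq
  window-injective (suc n) eq (suc i) (s≤s i<n) = window-injective n (List.∷-injectiveʳ eq) i i<n

  periodic-window-injective : ∀ {n s t} .{{_ : NonZero n}} → Periodic n s → Periodic n t →
                              window s n ≡ window t n → s ≗ t
  periodic-window-injective {n} {s} {t} ps pt eq i = trans (periodic-% {n} {s} ps i)
    (trans (window-injective n eq (i % n) (m%n<n i n)) (sym (periodic-% {n} {t} pt i)))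

  window-++ : ∀ s m n → window s m ++ window (shift m s) n ≡ window s (m + n)
  window-++ s zero    n = refl
  window-++ s (suc m) n = cong (s 0 ∷_) (window-++ (s ∘ suc) m n)

  window-^ : ∀ {n s} → Periodic n s → ∀ k → window s n ^ k ≡ window s (k * n)
  window-^         ps zero    = refl
  window-^ {n} {s} ps (suc k) = trans
    (cong (window s n ++_) (trans (window-^ {n} {s} ps k) (window-cong (k * n) λ i _ → sym (ps i))))
    (window-++ s n (k * n))

  drop-window : ∀ s k n → drop k (window s (k + n)) ≡ window (shift k s) n
  drop-window s zero    n = refl
  drop-window s (suc k) n = drop-window (s ∘ suc) k n

  take-window : ∀ s k n → take k (window s (k + n)) ≡ window s k
  take-window s zero    n = refl
  take-window s (suc k) n = cong (s 0 ∷_) (take-window (s ∘ suc) k n)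

  rotate-window : ∀ {n s} → Periodic n s → ∀ k → k ≤ n →
                  drop k (window s n) ++ take k (window s n) ≡ window (shift k s) n
  rotate-window {n} {s} ps k k≤n = begin
    drop k (window s n) ++ take k (window s n)
      ≡⟨ cong (λ m → drop k (window s m) ++ take k (window s m)) (sym n≡) ⟩
    drop k (window s (k + j)) ++ take k (window s (k + j))
      ≡⟨ cong₂ _++_ (drop-window s k j) (take-window s k j) ⟩
    window (shift k s) j ++ window s k
      ≡⟨ cong (window (shift k s) j ++_) (window-cong k λ i _ → sym (trans
           (cong s (trans (sym (ℕ.+-assoc k j i)) (cong (_+ i) n≡))) (ps i))) ⟩
    window (shift k s) j ++ window (shift j (shift k s)) k
      ≡⟨ window-++ (shift k s) j k ⟩
    window (shift k s) (j + k)
      ≡⟨ cong (window (shift k s)) (trans (ℕ.+-comm j k) n≡) ⟩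
    window (shift k s) n ∎
    where
    open ≡-Reasoning
    j = n ∸ k
    n≡ : k + j ≡ n
    n≡ = ℕ.m+[n∸m]≡n k≤n

  private
    nth : A → List A → ℕ → A
    nth d []       _       = d
    nth d (x ∷ xs) zero    = x
    nth d (x ∷ xs) (suc i) = nth d xs i

    window-nth : ∀ d xs → window (nth d xs) (length xs) ≡ xs
    window-nth d []       = refl
    window-nth d (x ∷ xs) = cong (x ∷_) (window-nth d xs)

  data Unrolled : List A → Set a where
    unrolled : ∀ s n .{{_ : NonZero n}} → Periodic n s → Unrolled (window s n)

  unroll : ∀ xs .{{_ : NonZero (length xs)}} → Unrolled xs
  unroll xs@(x ∷ xs′) = subst Unrolled
    (trans (window-cong n λ i i<n → cong (nth x xs) (m<n⇒m%n≡m i<n)) (window-nth x xs))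
    (unrolled s n λ i → cong (nth x xs) ([n+i]%n i))
    where
    n = length xs
    s : ℕ → A
    -- As i % n is below the length of xs, the default `x` is never read.
    s i = nth x xs (i % n)
    [n+i]%n : ∀ i → (n + i) % n ≡ i % n
    [n+i]%n i = trans (cong (_% n) (ℕ.+-comm n i)) ([m+n]%n≡m%n i n)

  module _ {R : Rel A ℓ} where

    private
      linked-window : ∀ s n → Linked R (window s (suc n)) → ∀ i → i < n → R (s i) (s (suc i))
      linked-window s (suc n) (r ∷ _)  zero    _         = r
      linked-window s (suc n) (_ ∷ rs) (suc i) (s≤s i<n) = linked-window (s ∘ suc) n rs i i<n

      -- By periodicity, the entry with which `Cyclic` closes a word is the next value of its
      -- sequence.
      closing : ∀ s n → Periodic (suc n) s → window s (suc n) ∷ʳ s 0 ≡ window s (suc (suc n))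
      closing s n ps = trans
        (cong (window s (suc n) ∷ʳ_) (sym (trans (cong s (sym (ℕ.+-identityʳ (suc n)))) (ps 0))))
        (List.applyUpTo-∷ʳ s (suc n))

    cyclic⇒ : ∀ {n s} .{{_ : NonZero n}} → Periodic n s → Cyclic R (window s n) →
              ∀ i → R (s i) (s (suc i))
    cyclic⇒ {suc n} {s} ps cyc i = subst₂ R (sym (periodic-% {suc n} {s} ps i))
      (sym (periodic-% {suc n} {shift 1 s} (periodic-shift {suc n} {s} 1 ps) i))
      (linked-window s (suc n) (subst (Linked R) (closing s n ps) cyc) (i % suc n) (m%n<n i (suc n)))

    cyclic⇐ : ∀ {n s} .{{_ : NonZero n}} → Periodic n s → (∀ i → R (s i) (s (suc i))) →
              Cyclic R (window s n)
    cyclic⇐ {suc n} {s} ps r =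
      subst (Linked R) (sym (closing s n ps)) (Linked.applyUpTo⁺₂ s (suc (suc n)) r)

  rotated : ∀ {n s C} .{{_ : NonZero n}} → Periodic n s → window s n ∼ C → ∃ λ k → window (shift k s) n ≡ C
  rotated {n} {s} ps (k , eq) = toℕ k , trans (sym (rotate-window {n} {s} ps (toℕ k)
    (subst (toℕ k ≤_) (length-window s n) (ℕ.<⇒≤ (Fin.toℕ<n k))))) eq

  -- `_∼_` admits only shifts smaller than the length, so k is first reduced modulo n.
  rotate : ∀ {n s} .{{_ : NonZero n}} → Periodic n s → ∀ k → window s n ∼ window (shift k s) n
  rotate {n} {s} ps k = fromℕ< k%n< , trans
    (cong (λ j → drop j (window s n) ++ take j (window s n)) (Fin.toℕ-fromℕ< k%n<))
    (trans (rotate-window {n} {s} ps (k % n) (ℕ.<⇒≤ (m%n<n k n)))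
      (window-cong n λ i _ → sym (shift-% {n} {s} ps k i)))
    where
    k%n< : k % n < length (window s n)
    k%n< = subst (k % n <_) (sym (length-window s n)) (m%n<n k n)

-- Enumerations of setoids

record Enumeration (S : Setoid c ℓ) : Set (c ⊔ ℓ) where
  field
    elements : List (Setoid.Carrier S)
    unique   : Unique S elements
    complete : IsEnumeration S elements

  size : ℕ
  size = length elements

open Enumeration public using (size)

lookup-injective : ∀ (S : Setoid c ℓ) {xs} → Unique S xs → ∀ i j →
                   Setoid._≈_ S (lookup xs i) (lookup xs j) → i ≡ j
lookup-injective S (_   ∷ _)   zero    zero    _  = refl
lookup-injective S (x∉ ∷ _)   zero    (suc j) eq =
  contradiction eq (All.lookup x∉ (∈-lookup j))
lookup-injective S (x∉ ∷ _)   (suc i) zero    eq =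
  contradiction (Setoid.sym S eq) (All.lookup x∉ (∈-lookup i))
lookup-injective S (_   ∷ xs!) (suc i) (suc j) eq = cong suc (lookup-injective S xs! i j eq)

module _ {S : Setoid c ℓ} {T : Setoid b ℓ′} where
  private
    module S = Setoid S
    module T = Setoid T

  -- Sending the position of an element to a position of its image is an injection between finite
  -- index sets. For this `f` has to reflect equality; respecting it is not asked for.
  size-≤ : (E : Enumeration S) (F : Enumeration T) (f : S.Carrier → T.Carrier) →
           (∀ x y → f x T.≈ f y → x S.≈ y) → size E ≤ size F
  size-≤ E F f reflects = Fin.injective⇒≤ {f = index} index-injective
    where
    module E = Enumeration E
    module F = Enumeration F
    found : ∀ i → Any (f (lookup E.elements i) T.≈_) F.elements
    found i = F.complete (f (lookup E.elements i))
    index : Fin (size E) → Fin (size F)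
    index i = Any.index (found i)
    index-injective : ∀ {i j} → index i ≡ index j → i ≡ j
    index-injective {i} {j} eq = lookup-injective S E.unique i j (reflects _ _ (T.trans
      (Any.lookup-index (found i)) (T.sym (subst
        (λ k → f (lookup E.elements j) T.≈ lookup F.elements k) (sym eq)
        (Any.lookup-index (found j))))))

  transport : (f : S.Carrier → T.Carrier) → (∀ {x y} → f x T.≈ f y → x S.≈ y) →
              (∀ {x y} → x S.≈ y → f x T.≈ f y) → (∀ y → ∃ λ x → y T.≈ f x) →
              (E : Enumeration S) → ∃ λ (F : Enumeration T) → size F ≡ size E
  transport f reflects preserves onto E = record
    { elements = List.map f E.elements
    ; unique   = Unique.map⁺ S T reflects E.unique
    ; complete = λ y → let x , y≈fx = onto y in
        Any.map⁺ (Any.map (T.trans y≈fx ∘ preserves) (E.complete x))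
    } , List.length-map f E.elements
    where module E = Enumeration E

size-≡ : {S : Setoid c ℓ} {T : Setoid b ℓ′} (E : Enumeration S) (F : Enumeration T)
         (f : Setoid.Carrier S → Setoid.Carrier T) (g : Setoid.Carrier T → Setoid.Carrier S) →
         (∀ x y → Setoid._≈_ T (f x) (f y) → Setoid._≈_ S x y) →
         (∀ x y → Setoid._≈_ S (g x) (g y) → Setoid._≈_ T x y) → size E ≡ size F
size-≡ E F f g f-reflects g-reflects =
  ℕ.≤-antisym (size-≤ E F f f-reflects) (size-≤ F E g g-reflects)

-- Pointwise equality stands in for function extensionality, and ignoring the proofs of `P` makes
-- each sequence count once.
sequences : {A : Set a} → Pred (ℕ → A) p → Setoid _ _
sequences {A = A} P = record
  { Carrier = Σ (ℕ → A) P
  ; _≈_ = λ x y → ∀ i → proj₁ x i ≡ proj₁ y i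
  ; isEquivalence = record
    { refl  = λ _ → refl
    ; sym   = λ eq i → sym (eq i)
    ; trans = λ eq eq′ i → trans (eq i) (eq′ i)
    }
  }

-- `Q?` receives the element together with its proof of `P`, because that proof may be what makes
-- `Q` decidable.
restrict : {A : Set a} {P : Pred (ℕ → A) p} {Q : Pred (ℕ → A) q} →
           (∀ {s} → Q s → P s) → (Q? : ∀ x → Dec (Q (proj₁ x))) →
           (∀ {s t} → (∀ i → s i ≡ t i) → Q s → Q t) →
           Enumeration (sequences P) → Enumeration (sequences Q)
restrict {A = A} {P = P} {Q} Q⇒P Q? Q-resp E = record
  { elements = select E.elements
  ; unique   = select-unique E.unique
  ; complete = λ (s , Qs) → select-complete (s , Q⇒P Qs) Qs (E.complete (s , Q⇒P Qs))
  }
  where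
  module E = Enumeration E
  S = sequences P
  T = sequences Q
  select : List (Setoid.Carrier S) → List (Setoid.Carrier T)
  select [] = []
  select ((s , Ps) ∷ xs) with Q? (s , Ps)
  ... | yes Qs = (s , Qs) ∷ select xs
  ... | no  _  = select xs
  select-all : ∀ s xs → All (λ x → ¬ (∀ i → s i ≡ proj₁ x i)) xs →
               All (λ x → ¬ (∀ i → s i ≡ proj₁ x i)) (select xs)
  select-all s [] [] = []
  select-all s (x ∷ xs) (s≉x ∷ s≉xs) with Q? x
  ... | yes _ = s≉x ∷ select-all s xs s≉xs
  ... | no  _ = select-all s xs s≉xs
  select-unique : ∀ {xs} → Unique S xs → Unique T (select xs)
  select-unique [] = []
  select-unique {x ∷ xs} (x∉ ∷ xs!) with Q? x
  ... | yes _ = select-all (proj₁ x) xs x∉ ∷ select-unique xs!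
  ... | no  _ = select-unique xs!
  select-complete : ∀ (x : Setoid.Carrier S) (Qx : Q (proj₁ x)) {xs} → Membership._∈_ S x xs →
                    Membership._∈_ T (proj₁ x , Qx) (select xs)
  select-complete x Qx {y ∷ ys} x∈ with Q? y | x∈
  ... | yes _  | here x≈y  = here x≈y
  ... | yes _  | there x∈ys = there (select-complete x Qx x∈ys)
  ... | no ¬Qy | here x≈y  = contradiction (Q-resp {proj₁ x} {proj₁ y} x≈y Qx) ¬Qy
  ... | no _   | there x∈ys = select-complete x Qx x∈ys

-- Closed walks and primes

cyclic⇒nonEmpty : {R : Rel A p} (C : List A) → Cyclic R C → NonZero (length C)
cyclic⇒nonEmpty (_ ∷ _) _ = _

∼-refl : (C : List A) .{{_ : NonZero (length C)}} → C ∼ C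
∼-refl C@(x ∷ xs) = zero , List.++-identityʳ C

-- Both rotations are shifts of one periodic sequence, so they compose by adding the shifts.
∼-trans : {C C′ C″ : List A} → C ∼ C′ → C′ ∼ C″ → C ∼ C″
∼-trans {C = C} C∼C′@(k₀ , _) C′∼C″ with unroll C {{Fin.nonZeroIndex k₀}}
... | unrolled s n ps
  with k  , refl ← rotated {n = n} {s} ps C∼C′
  with k′ , refl ← rotated {n = n} {shift k s} (periodic-shift {n = n} {s} k ps) C′∼C″
  = subst (window s n ∼_) (window-cong n λ i _ → cong s (ℕ.+-assoc k k′ i)) (rotate {n = n} {s} ps (k + k′))

AllPairs-deduplicate⁺ : ∀ {R : Rel A r} (R? : Decidable R) xs →
                        AllPairs (λ x y → ¬ R x y) (deduplicate R? xs)
AllPairs-deduplicate⁺ R? []       = []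
AllPairs-deduplicate⁺ R? (x ∷ xs) = All.all-filter (¬? ∘ R? x) (deduplicate R? xs)
  ∷ AllPairs.filter⁺ (¬? ∘ R? x) (AllPairs-deduplicate⁺ R? xs)

∈-words⁺ : ∀ {xs : List A} (w : List A) → All (_∈ xs) w → w ∈ words (length w) xs
∈-words⁺ []      []            = here refl
∈-words⁺ (x ∷ w) (x∈xs ∷ w∈xs) = ∈-cartesianProductWith⁺ _∷_ x∈xs (∈-words⁺ w w∈xs)

∈-words⁻ : ∀ l {xs w : List A} → w ∈ words l xs → length w ≡ l
∈-words⁻ zero    (here refl) = refl
∈-words⁻ (suc l) {xs} w∈ with _ , _ , _ , w′∈ , refl ← ∈-cartesianProductWith⁻ _∷_ xs (words l xs) w∈ =
  cong suc (∈-words⁻ l w′∈)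

module _ (Γ : Graph) where

  -- In a simple graph the vertices determine the directed edges, and an edge is the opposite of the
  -- next one exactly when s(i) = s(i + 2). For a periodic sequence these conditions include the one
  -- at the closing vertex.
  record NonBacktrackingWalk (s : ℕ → V Γ) : Set where
    field
      adjacent : ∀ i → Adj Γ (s i) (s (suc i))
      forward  : ∀ i → s i ≢ s (suc (suc i))

  ClosedWalks : ℕ → Setoid _ _
  ClosedWalks m = sequences (λ s → NonBacktrackingWalk s × Periodic m s)

-- Edge walks, primitive roots and the list of primes

module ClosedWalk (Γ : Graph) where
  open Ihara Γ
  open Graph Γ using (adj?)
  open NonBacktrackingWalk

  record EdgeWalk (e : ℕ → DEdge) : Set where
    field
      connected : ∀ i → target (e i) ≡ source (e (suc i))
      reduced   : ∀ i → e i ≢ opposite (e (suc i))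
  open EdgeWalk

  ∈-dedges : ∀ e → e ∈ dedges
  ∈-dedges e@((v , w) Refinement., [ vw ]) = Any.mapMaybe⁺ edge? _ (Any.map⁺ (Any.map found
    (∈-cartesianProduct⁺ (Graph.enumerates Γ v) (Graph.enumerates Γ w))))
    where
    edge? : V Γ × V Γ → Maybe.Maybe DEdge
    edge? vw = Maybe.map (λ vw∈E → vw Refinement., [ vw∈E ]) (dec⇒maybe (adj? (proj₁ vw) (proj₂ vw)))
    found : ∀ {x} → (v , w) ≡ x → MaybeAny.Any (e ≡_) (edge? x)
    found refl with adj? v w
    ... | yes _   = MaybeAny.just (Refinement.value-injective refl)
    ... | no  ¬vw = contradiction (recompute (adj? v w) vw) ¬vw

  edges : ∀ {s} → NonBacktrackingWalk Γ s → ℕ → DEdge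
  edges {s} w i = (s i , s (suc i)) Refinement., [ adjacent w i ]

  edges-walk : ∀ {s} (w : NonBacktrackingWalk Γ s) → EdgeWalk (edges w)
  edges-walk w = record
    { connected = λ _ → refl
    ; reduced   = λ i eq → forward w i (cong source eq)
    }

  shift-walk : ∀ {e} k → EdgeWalk e → EdgeWalk (shift k e)
  shift-walk {e} k w = record
    { connected = λ i → trans (connected w (k + i)) (cong (source ∘ e) (sym (ℕ.+-suc k i)))
    ; reduced   = λ i eq → reduced w (k + i) (trans eq (cong (opposite ∘ e) (ℕ.+-suc k i)))
    }

  source-injective : ∀ {e f} → EdgeWalk e → EdgeWalk f → source ∘ e ≗ source ∘ f → e ≗ f
  source-injective we wf eq i = Refinement.value-injective
    (cong₂ _,_ (eq i) (trans (connected we i) (trans (eq (suc i)) (sym (connected wf i)))))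

  vertex-walk : ∀ {e} → EdgeWalk e → NonBacktrackingWalk Γ (source ∘ e)
  vertex-walk {e} w = record
    { adjacent = λ i → subst (Adj Γ (source (e i))) (connected w i) (adj (e i))
    ; forward  = λ i eq → reduced w i (Refinement.value-injective (cong₂ _,_
        (trans eq (sym (connected w (suc i)))) (connected w i)))
    }
    where
    adj : ∀ e → Adj Γ (source e) (target e)
    adj (_ Refinement., [ vw ]) = recompute (adj? _ _) vw

  source-periodic⁻ : ∀ {e n} → EdgeWalk e → Periodic n (source ∘ e) → Periodic n e
  source-periodic⁻ {n = n} w = source-injective (shift-walk n w) w

  -- The gcd g of p and n is a period too, so the window of length n is the (n / g)-th power of the
  -- one of length g. As it is no proper power, n = g, which divides p.
  minimal-period : ∀ {e n p} .{{_ : NonZero n}} → EdgeWalk e → Periodic n e →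
              ¬ ProperPower (window e n) → Periodic p e → n ∣ p
  minimal-period {e} {n} {p} {{n≢0}} w pn ¬power pp
    with gcd p n in g≡ | gcd[m,n]∣m p n | gcd[m,n]∣n p n | periodic-gcd {m = p} {n} {e} pp pn
  ... | g | g∣p | divides zero          refl | pg = contradiction refl (ℕ.≢-nonZero⁻¹ 0 {{n≢0}})
  ... | g | g∣p | divides (suc zero)    refl | pg = subst (_∣ p) (sym (ℕ.+-identityʳ g)) g∣p
  ... | zero | g∣p | divides q@(suc (suc _)) refl | pg =
    contradiction (ℕ.*-zeroʳ q) (ℕ.≢-nonZero⁻¹ _ {{n≢0}})
  ... | g@(suc _) | g∣p | divides q@(suc (suc _)) refl | pg = contradiction
    (window e g , q , cyclic⇐ {n = g} {e} pg (connected w) , s≤s (s≤s z≤n) , window-^ {n = g} {e} pg q)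
    ¬power

  -- If the window is D ^ k with k > 1, the unrolling of D is also n-periodic with the same window,
  -- hence equals `e`. So the length of D is a smaller period dividing n, and the descent continues
  -- until the window is prime.
  primitiveRoot : ∀ {e n} .{{_ : NonZero n}} → EdgeWalk e → Periodic n e →
                  ∃ λ d → NonZero d × d ∣ n × Periodic d e × PrimeCycle (window e d)
  primitiveRoot {e} w = go _ (<-wellFounded _)
    where
    go : ∀ n → Acc _<_ n → .{{_ : NonZero n}} → Periodic n e →
         ∃ λ d → NonZero d × d ∣ n × Periodic d e × PrimeCycle (window e d)
    go n@(suc _) (acc rec) pn with properPower? (window e n)
    ... | no ¬power = n , _ , ∣-refl , pn , mkPrimeCycle
            (cyclic⇐ {n = n} {e} pn (connected w)) (cyclic⇐ {n = n} {e} pn (reduced w)) ¬power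
    ... | yes (D , k , cycle , 1<k , D^k≡) with unroll D {{cyclic⇒nonEmpty D cycle}}
    ...   | unrolled f l {{l≢0}} pf = let d , d≢0 , d∣l , rest = go l (rec l<n) pl in
              d , d≢0 , ∣-trans d∣l (divides k n≡) , rest
      where
      windows≡ : window f (k * l) ≡ window e n
      windows≡ = trans (sym (window-^ {n = l} {f} pf k)) D^k≡
      n≡ : n ≡ k * l
      n≡ = trans (sym (length-window e n)) (trans (cong length (sym windows≡)) (length-window f (k * l)))
      l<n : l < n
      l<n = subst (l <_) (sym n≡) (subst (_< k * l) (ℕ.*-identityˡ l) (ℕ.*-monoˡ-< l 1<k))
      pl : Periodic l e
      pl = periodic-cong {n = l} {f} (periodic-window-injective {n = n} {f} {e}
        (subst (λ m → Periodic m f) (sym n≡) (periodic-* {n = l} {f} pf k)) pn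
        (trans (cong (window f) n≡) windows≡)) pf

  primes-prime : ∀ l → All PrimeCycle (primes l)
  primes-prime l = All.deduplicate⁺ _∼?_ (All.all-filter primeCycle? (words l dedges))

  primes-length : ∀ l {C} → C ∈ primes l → length C ≡ l
  primes-length l C∈ = ∈-words⁻ l {dedges}
    (proj₁ (∈-filter⁻ primeCycle? {xs = words l dedges} (∈-deduplicate⁻ _∼?_ _ C∈)))

  primes-complete : ∀ {C} .{{_ : NonZero (length C)}} → PrimeCycle C → Any (_∼ C) (primes (length C))
  primes-complete {C} prime = Any.deduplicate⁺ _∼?_ ∼-trans
    (Any.map (λ { refl → ∼-refl C })
      (∈-filter⁺ primeCycle? (∈-words⁺ C (All.tabulate λ _ → ∈-dedges _)) prime))

  primesUpTo : ℕ → List (List DEdge)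
  primesUpTo n = concatMap primes (applyUpTo suc n)

  ∼-length : ∀ {C C′ : List DEdge} → C ∼ C′ → length C ≡ length C′
  ∼-length {C} (k , refl) = trans (cong length (sym (List.take++drop≡id (toℕ k) C)))
    (trans (List.length-++ (take (toℕ k) C)) (trans (ℕ.+-comm (length (take (toℕ k) C)) _)
      (sym (List.length-++ (drop (toℕ k) C)))))

  primesUpTo-prime : ∀ n → All PrimeCycle (primesUpTo n)
  primesUpTo-prime n = All.concat⁺ (All.map⁺ (All.applyUpTo⁺₂ suc n (primes-prime ∘ suc)))

  primesUpTo-inequivalent : ∀ n → AllPairs (λ C C′ → ¬ C ∼ C′) (primesUpTo n)
  primesUpTo-inequivalent n = AllPairs.concat⁺
    (All.map⁺ (All.applyUpTo⁺₂ suc n λ l →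
      AllPairs-deduplicate⁺ _∼?_ (filter primeCycle? (words (suc l) dedges))))
    (AllPairs.map⁺ (AllPairs.applyUpTo⁺₁ suc n λ {i} {j} i<j _ →
      All.tabulate λ C∈ → All.tabulate λ C′∈ C∼C′ → ℕ.<⇒≢ (s≤s i<j)
        (trans (sym (primes-length _ C∈)) (trans (∼-length C∼C′) (primes-length _ C′∈)))))

  primesUpTo-complete : ∀ n {C} .{{_ : NonZero (length C)}} → PrimeCycle C → length C ≤ n →
                        Any (_∼ C) (primesUpTo n)
  primesUpTo-complete n {C@(_ ∷ C′)} prime C≤n = Any.concatMap⁺ primes
    (Any.applyUpTo⁺ suc (primes-complete prime) C≤n)

-- Closed walks as rotations of primes

module _ (Γ : Graph) where
  open Ihara Γ
  open ClosedWalk Γ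
  open PrimeCycle

  -- The unrolling of a prime cycle. Primality enters as `minimal`: the length of C is the least
  -- period and divides all others.
  record PrimeSequence (C : List DEdge) : Set where
    field
      {{nonZero}} : NonZero (length C)
      sequence : ℕ → DEdge
      periodic : Periodic (length C) sequence
      window≡  : window sequence (length C) ≡ C
      walk     : EdgeWalk sequence
      minimal  : ∀ {p} → Periodic p sequence → length C ∣ p

  primeSequence : ∀ {C} → PrimeCycle C → PrimeSequence C
  primeSequence {C} prime with nz ← cyclic⇒nonEmpty C (isCycle prime) | unroll C {{nz}}
  ... | unrolled s n ps = record
    { nonZero  = nz
    ; sequence = s
    ; periodic = subst (λ l → Periodic l s) (sym len) ps
    ; window≡  = cong (window s) len
    ; walk     = w
    ; minimal  = λ {p} pp → subst (_∣ p) (sym len) (minimal-period {p = p} w ps (¬properPower prime) pp)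
    }
    where
    len : length (window s n) ≡ n
    len = length-window s n
    w : EdgeWalk s
    w = record
      { connected = cyclic⇒ {n = n} {s} ps (isCycle prime)
      ; reduced   = cyclic⇒ {n = n} {s} ps (nonBacktracking prime)
      }

  vertices-of : ∀ {C} → PrimeSequence C → ℕ → ℕ → V Γ
  vertices-of P k = source ∘ shift k (PrimeSequence.sequence P)

  -- Otherwise j - i would be a positive period below the minimal one.
  shift-injective : ∀ {C} (P : PrimeSequence C) i j → i < j → j < length C →
                    ¬ (vertices-of P i ≗ vertices-of P j)
  shift-injective {C} P i j i<j j<n eq = contradiction
    (∣⇒≤ {{ℕ.>-nonZero (ℕ.m<n⇒0<n∸m i<j)}} (minimal (periodic-unshift {n = length C} {j ∸ i} {sequence} i periodic period)))
    (ℕ.<⇒≱ (ℕ.≤-<-trans (ℕ.m∸n≤m j i) j<n))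
    where
    open PrimeSequence P
    edges≗ : shift i sequence ≗ shift j sequence
    edges≗ = source-injective (shift-walk i walk) (shift-walk j walk) eq
    period : Periodic (j ∸ i) (shift i sequence)
    period l = trans (cong sequence (trans (sym (ℕ.+-assoc i (j ∸ i) l))
      (cong (_+ l) (ℕ.m+[n∸m]≡n (ℕ.<⇒≤ i<j))))) (sym (edges≗ l))

  -- A common shift has both lengths as minimal period, so each divides the other and they agree.
  -- Undoing the shift by k′ then exhibits C′ as a rotation of C.
  orbit-disjoint : ∀ {C C′} (P : PrimeSequence C) (P′ : PrimeSequence C′) k k′ →
                   vertices-of P k ≗ vertices-of P′ k′ → C ∼ C′
  orbit-disjoint {C} {C′} P P′ k k′ eq = subst₂ _∼_ P.window≡
    (trans (window-cong (length C) λ p _ → sym (shifted p))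
      (trans (cong (window P′.sequence) lengths≡) P′.window≡))
    (rotate {n = length C} {P.sequence} P.periodic (k + j))
    where
    module P  = PrimeSequence P
    module P′ = PrimeSequence P′
    edges≗ : shift k P.sequence ≗ shift k′ P′.sequence
    edges≗ = source-injective (shift-walk k P.walk) (shift-walk k′ P′.walk) eq
    lengths≡ : length C ≡ length C′
    lengths≡ = ∣-antisym
      (P.minimal (periodic-unshift {n = length C} {length C′} {P.sequence} k P.periodic
        (periodic-cong {n = length C′} (λ i → sym (edges≗ i)) (periodic-shift {n = length C′} k′ P′.periodic))))
      (P′.minimal (periodic-unshift {n = length C′} {length C} {P′.sequence} k′ P′.periodic
        (periodic-cong {n = length C} edges≗ (periodic-shift {n = length C} k P.periodic))))
    unshifted = unshift {n = length C′} {P′.sequence} P′.periodic k′ 0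
    j = proj₁ unshifted
    shifted : ∀ p → P′.sequence p ≡ P.sequence (k + j + p)
    shifted p = trans (cong P′.sequence (sym (ℕ.+-identityʳ p))) (trans (proj₂ unshifted p)
      (trans (sym (edges≗ (p + j))) (cong P.sequence
        (trans (cong (ℕ._+_ k) (ℕ.+-comm p j)) (sym (ℕ.+-assoc k j p))))))

  module _ (m : ℕ) .{{_ : NonZero m}} where
    private
      S = ClosedWalks Γ m
      module S = Setoid S
      infix 4 _∈ₛ_
      _∈ₛ_ = Membership._∈_ S

    rotation : ∀ {C} (P : PrimeSequence C) → length C ∣ m → ℕ → S.Carrier
    rotation {C} P C∣m k = vertices-of P k , vertex-walk (shift-walk k walk) ,
      λ i → cong source (periodic-∣ {s = shift k sequence} C∣m (periodic-shift {n = length C} k periodic) i)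
      where open PrimeSequence P

    rotations : ∀ {Cs} → All PrimeSequence Cs → List S.Carrier
    rotations []                 = []
    rotations (_∷_ {C} P Ps) with length C ∣? m
    ... | yes C∣m = applyUpTo (rotation P C∣m) (length C) ++ rotations Ps
    ... | no  _   = rotations Ps

    rotations⁻ : ∀ {Cs} (Ps : All PrimeSequence Cs) w → w ∈ₛ rotations Ps →
                 Any (λ C → ∃₂ λ (P : PrimeSequence C) k → proj₁ w ≗ vertices-of P k) Cs
    rotations⁻ (_∷_ {C} P Ps) w w∈ with length C ∣? m
    ... | no  _   = there (rotations⁻ Ps w w∈)
    ... | yes C∣m with Any.++⁻ (applyUpTo (rotation P C∣m) (length C)) w∈
    ...   | inj₂ w∈Ps = there (rotations⁻ Ps w w∈Ps)
    ...   | inj₁ w∈P  with k , _ , eq ← Any.applyUpTo⁻ (rotation P C∣m) w∈P = here (P , k , eq)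

    -- The hypothesis ranges over every unrolling P of C, since the one stored in `Ps` is not
    -- visible to `Any` over `Cs`.
    rotations⁺ : ∀ {Cs} (Ps : All PrimeSequence Cs) w →
                 Any (λ C → length C ∣ m × (∀ (P : PrimeSequence C) → ∃ λ k → proj₁ w ≗ vertices-of P k)) Cs →
                 w ∈ₛ rotations Ps
    rotations⁺ (_∷_ {C} P Ps) w any with length C ∣? m | any
    ... | yes _   | there any′ = Any.++⁺ʳ _ (rotations⁺ Ps w any′)
    ... | no  _   | there any′ = rotations⁺ Ps w any′
    ... | no  C∤m | here (C∣m , _) = contradiction C∣m C∤m
    ... | yes C∣m | here (_ , reach) with k , eq ← reach P = Any.++⁺ˡ
      (Any.applyUpTo⁺ (rotation P C∣m) (λ i → trans (eq i) (cong source (shift-% {n = length C} {sequence} periodic k i)))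
        (m%n<n k (length C)))
      where open PrimeSequence P

    rotations-unique : ∀ {Cs} (Ps : All PrimeSequence Cs) → AllPairs (λ C C′ → ¬ C ∼ C′) Cs →
                       Unique S (rotations Ps)
    rotations-unique []               []         = []
    rotations-unique (_∷_ {C} P Ps) (C≁ ∷ Cs≁) with length C ∣? m
    ... | no  _   = rotations-unique Ps Cs≁
    ... | yes C∣m = Unique.++⁺ S
      (Unique.applyUpTo⁺₁ S (rotation P C∣m) (length C) (λ {i} {j} → shift-injective P i j))
      (rotations-unique Ps Cs≁)
      λ {w} (w∈P , w∈Ps) →
        let k , _ , eq = Any.applyUpTo⁻ (rotation P C∣m) w∈P
            C∼ = Any.map (λ (P′ , k′ , eq′) → orbit-disjoint P P′ k k′ λ i → trans (sym (eq i)) (eq′ i))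
                   (rotations⁻ Ps w w∈Ps)
        in All.All¬⇒¬Any C≁ C∼

  length-rotations : ∀ m {Cs} (Ps : All PrimeSequence Cs) →
                     length (rotations (suc m) Ps) ≡ powerSum (List.map length Cs) (suc m)
  length-rotations m []             = refl
  length-rotations m (_∷_ {C} P Ps) with length C ∣? suc m
  ... | no  _   = length-rotations m Ps
  ... | yes C∣m = trans (List.length-++ (applyUpTo (rotation (suc m) P C∣m) (length C)))
    (cong₂ _+_ (List.length-applyUpTo _ (length C)) (length-rotations m Ps))

  -- A prime whose length k divides m has exactly k distinct rotations of period m. Any bound n ≥ m
  -- is allowed: comparing two bounds shows that the power sum at m does not depend on n.
  closedWalks : ∀ {n} m .{{_ : NonZero m}} → m ≤ n →
                ∃ λ (E : Enumeration (ClosedWalks Γ m)) →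
                  size E ≡ powerSum (List.map length (primesUpTo n)) m
  closedWalks {n} m@(suc m-1) m≤n = record
    { elements = rotations m Ps
    ; unique   = rotations-unique m Ps (primesUpTo-inequivalent n)
    ; complete = λ (s , w , ps) → rotations⁺ m Ps (s , w , ps) (found w ps)
    } , length-rotations m-1 Ps
    where
    Ps : All PrimeSequence (primesUpTo n)
    Ps = All.map primeSequence (primesUpTo-prime n)
    found : ∀ {s} (w : NonBacktrackingWalk Γ s) → Periodic m s →
            Any (λ C → length C ∣ m × (∀ (P : PrimeSequence C) → ∃ λ k → s ≗ vertices-of P k)) (primesUpTo n)
    -- The primitive root of the walk is a prime cycle of length d dividing m, so the listed
    -- representative of its class rotates to it.
    found {s} w ps with d , d≢0 , d∣m , pd , prime ←
        primitiveRoot {n = m} (edges-walk w) (source-periodic⁻ {n = m} (edges-walk w) ps) =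
      Any.map reach (primesUpTo-complete n {{subst NonZero (sym len) d≢0}} prime
        (subst (_≤ n) (sym len) (ℕ.≤-trans (∣⇒≤ d∣m) m≤n)))
      where
      instance _ = d≢0
      len : length (window (edges w) d) ≡ d
      len = length-window (edges w) d
      reach : ∀ {C} → C ∼ window (edges w) d →
              length C ∣ m × (∀ (P : PrimeSequence C) → ∃ λ k → s ≗ vertices-of P k)
      reach {C} C∼ = subst (_∣ m) (sym length≡) d∣m , λ P → rotated-by P
        where
        length≡ : length C ≡ d
        length≡ = trans (∼-length C∼) len
        rotated-by : ∀ (P : PrimeSequence C) → ∃ λ k → s ≗ vertices-of P k
        rotated-by P =
          let k , eq = rotated {n = length C} {sequence} periodic
                (subst (_∼ window (edges w) d) (sym window≡) C∼)
          in k , λ i → cong source (sym (periodic-window-injective {n = d} {shift k sequence} {edges w}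
               (subst (λ l → Periodic l (shift k sequence)) length≡ (periodic-shift {n = length C} k periodic))
               pd (trans (cong (window (shift k sequence)) (sym length≡)) eq) i))
          where open PrimeSequence P

-- The logarithmic derivative of the zeta function

module _ (Γ : Graph) where
  open Ihara Γ
  open ClosedWalk Γ

  private
    lengths : ℕ → List ℕ
    lengths n = List.map length (primesUpTo n)

    lengths-nonZero : ∀ n → All NonZero (lengths n)
    lengths-nonZero n = All.map⁺ (All.map (λ {C} prime → cyclic⇒nonEmpty C (PrimeCycle.isCycle prime))
      (primesUpTo-prime n))

    partialζ : ℕ → PowerSeries
    partialζ n = ∏ (List.map geometric (lengths n))

  -- A power sum rather than a size, because at m = 0 periodicity is no condition; the value there
  -- is 0.
  closedWalkCount : ℕ → ℕ
  closedWalkCount m = powerSum (lengths m) m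

  size-closedWalks : ∀ m .{{_ : NonZero m}} (E : Enumeration (ClosedWalks Γ m)) → size E ≡ closedWalkCount m
  size-closedWalks m E = let F , size≡ = closedWalks Γ {m} m ℕ.≤-refl in
    trans (size-≡ E F id id (λ _ _ → id) (λ _ _ → id)) size≡

  private
    powerSum-stable : ∀ {m n} → m ≤ n → powerSum (lengths n) m ≡ closedWalkCount m
    powerSum-stable {zero}      _   = refl
    powerSum-stable {m@(suc _)} m≤n = let E , size≡ = closedWalks Γ m m≤n in
      trans (sym size≡) (size-closedWalks m E)

    -- The logarithmic derivatives of the products over primes up to n and up to m agree through
    -- degree m, hence so do the products.
    partialζ-stable : ∀ {m n} → m ≤ n → partialζ n m ≡ ζ Γ m
    partialζ-stable {m} {n} m≤n = trans
      (logDerivative-unique {+_ ∘ powerSum (lengths n)} {+_ ∘ powerSum (lengths m)} m refl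
        (trans (∏-geometric-zero (lengths-nonZero n)) (sym (∏-geometric-zero (lengths-nonZero m))))
        (λ i i≤m → cong +_ (trans (powerSum-stable (ℕ.≤-trans i≤m m≤n)) (sym (powerSum-stable i≤m))))
        (λ i _ → ∏-geometric-logDerivative (lengths-nonZero n) i)
        (λ i _ → ∏-geometric-logDerivative (lengths-nonZero m) i))
      (cong (λ fs → ∏ fs m) (sym (List.map-∘ (primesUpTo m))))

  -- Degree n involves only coefficients up to n, where `ζ Γ` agrees with the single product
  -- `partialζ n`.
  ζ-logDerivative : IsLogDerivative (+_ ∘ closedWalkCount) (ζ Γ)
  ζ-logDerivative n = trans (cong (+ n ℤ.*_) (sym (partialζ-stable {n} ℕ.≤-refl)))
    (trans (∏-geometric-logDerivative (lengths-nonZero n) n)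
      (⊛-cong-≤ {+_ ∘ powerSum (lengths n)} n (λ i i≤n → cong +_ (powerSum-stable i≤n))
        (λ i i≤n → partialζ-stable i≤n)))

-- Twisted walks in covers

length-cartesianProduct : ∀ {A : Set a} {B : Set p} (xs : List A) (ys : List B) →
                          length (cartesianProduct xs ys) ≡ length xs * length ys
length-cartesianProduct []       ys = refl
length-cartesianProduct (x ∷ xs) ys = trans (List.length-++ (List.map (x ,_) ys))
  (cong₂ _+_ (List.length-map (x ,_) ys) (length-cartesianProduct xs ys))

sequences-union : ∀ {A : Set a} {r} (P : Fin r → Pred (ℕ → A) p) →
  (∀ {s t} i j → s ≗ t → P i s → P j t → i ≡ j) → (E : ∀ i → Enumeration (sequences (P i))) →
  ∃ λ (F : Enumeration (sequences (λ s → ∃ λ i → P i s))) → size F ≡ ListAction.sum (tabulate (size ∘ E))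
sequences-union {r = r} P disjoint E = record
  { elements = concat (tabulate family)
  ; unique   = Unique.concat⁺ S
      (All.tabulate⁺ λ i → Unique.map⁺ (sequences (P i)) S id (E.unique i))
      (AllPairs.tabulate⁺ λ {i} {j} i≢j {x} (x∈i , x∈j) → i≢j (
        let y , x≈y = from i x x∈i
            z , x≈z = from j x x∈j
        in disjoint i j (λ n → trans (sym (x≈y n)) (x≈z n)) (proj₂ y) (proj₂ z)))
  ; complete = λ (s , i , Ps) → Any.concat⁺ (Any.tabulate⁺ i (Any.map⁺ (E.complete i (s , Ps))))
  } , trans (length-concat family)
        (cong ListAction.sum (List.tabulate-cong λ i → List.length-map (inject i) (E.elements i)))
  where
  module E i = Enumeration (E i)
  S = sequences (λ s → ∃ λ i → P i s)
  inject : ∀ i → Setoid.Carrier (sequences (P i)) → Setoid.Carrier S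
  inject i (s , Ps) = s , i , Ps
  family : Fin r → List (Setoid.Carrier S)
  family i = List.map (inject i) (E.elements i)
  from : ∀ i x → Any (Setoid._≈_ S x) (family i) → ∃ λ (y : Setoid.Carrier (sequences (P i))) → proj₁ x ≗ proj₁ y
  from i x x∈ = Any.satisfied (Any.map⁻ x∈)
  length-concat : ∀ {b} {B : Set b} {r} (f : Fin r → List B) →
                  length (concat (tabulate f)) ≡ ListAction.sum (tabulate (length ∘ f))
  length-concat {r = zero}  f = refl
  length-concat {r = suc r} f = trans (List.length-++ (f zero))
    (cong (ℕ._+_ (length (f zero))) (length-concat (f ∘ suc)))

open NonBacktrackingWalk

walk-cong : ∀ {Γ} {s t} → s ≗ t → NonBacktrackingWalk Γ s → NonBacktrackingWalk Γ t
walk-cong {Γ} s≗t w = record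
  { adjacent = λ i → subst₂ (Adj Γ) (s≗t i) (s≗t (suc i)) (adjacent w i)
  ; forward  = λ i → subst₂ _≢_ (s≗t i) (s≗t (suc (suc i))) (forward w i)
  }

-- Unique path lifting

module CoverProperties {Y Z : Graph} (π : Cover Y Z) where
  open Cover π

  neighbour : ∀ v {z} → Adj Z (map v) z → ∃ λ w → Adj Y v w × map w ≡ z
  neighbour v {z} vz with (w Refinement., [ vw ]) , eq ← proj₂ (star-bijective v) (z Refinement., [ vz ]) =
    w , recompute (Graph.adj? Y v w) vw , cong value (eq refl)

  neighbour-unique : ∀ {v w w′} → Adj Y v w → Adj Y v w′ → map w ≡ map w′ → w ≡ w′
  neighbour-unique {v} vw vw′ eq = cong value (proj₁ (star-bijective v)
    {_ Refinement., [ vw ]} {_ Refinement., [ vw′ ]} (Refinement.value-injective eq))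

  module _ {t : ℕ → V Z} (walk : NonBacktrackingWalk Z t) (v : V Y) (v-over : map v ≡ t 0) where

    private
      lifts : ∀ i → ∃ λ w → map w ≡ t i
      next  : ∀ i → ∃ λ w → Adj Y (proj₁ (lifts i)) w × map w ≡ t (suc i)
      lifts zero    = v , v-over
      lifts (suc i) = proj₁ (next i) , proj₂ (proj₂ (next i))
      next i = neighbour (proj₁ (lifts i))
        (subst (λ z → Adj Z z (t (suc i))) (sym (proj₂ (lifts i))) (adjacent walk i))

    lift : ℕ → V Y
    lift = proj₁ ∘ lifts

    lift-over : map ∘ lift ≗ t
    lift-over = proj₂ ∘ lifts

    lift-walk : NonBacktrackingWalk Y lift
    lift-walk = record
      { adjacent = λ i → proj₁ (proj₂ (next i))
      ; forward  = λ i eq → forward walk i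
          (trans (sym (lift-over i)) (trans (cong map eq) (lift-over (suc (suc i)))))
      }

  lift-unique : ∀ {s t} → NonBacktrackingWalk Y s → NonBacktrackingWalk Y t →
                map ∘ s ≗ map ∘ t → s 0 ≡ t 0 → s ≗ t
  lift-unique         ws wt over start zero    = start
  lift-unique {s} {t} ws wt over start (suc i) = neighbour-unique (adjacent ws i)
    (subst (λ v → Adj Y v (t (suc i))) (sym (lift-unique ws wt over start i)) (adjacent wt i))
    (over (suc i))

  -- A backtrack in Z would put s(i) and s(i + 2), both neighbours of s(i + 1), over one vertex; the
  -- bijection of stars then identifies them.
  map-walk : ∀ {s} → NonBacktrackingWalk Y s → NonBacktrackingWalk Z (map ∘ s)
  map-walk {s} w = record
    { adjacent = λ i → map-adj (adjacent w i)
    ; forward  = λ i eq → forward w i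
        (neighbour-unique (Graph.adj-sym Y (adjacent w i)) (adjacent w (suc i)) eq)
    }

-- Counting twisted walks

module _ {Y X : Graph} {cover : Cover Y X} {G : Group c ℓ} (action : FibrewiseRegularAction cover G) where
  open Group G using (Carrier; _≈_; _∙_; _⁻¹; ε; inverseˡ)
  open GroupProperties G using (⁻¹-involutive; inverseʳ-unique)
  open FibrewiseRegularAction action
  private
    module G = Group G
    module P = Cover cover

  inverse-act : ∀ g v → g ⁻¹ · g · v ≡ v
  inverse-act g v = trans (sym (∙-act (g ⁻¹) g v)) (trans (·-cong (inverseˡ g) v) (ε-act v))

  ·-injective : ∀ g {v w} → g · v ≡ g · w → v ≡ w
  ·-injective g {v} {w} eq = trans (sym (inverse-act g v)) (trans (cong (g ⁻¹ ·_) eq) (inverse-act g w))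

  ·-unique : ∀ {g h v} → g · v ≡ h · v → g ≈ h
  ·-unique {g} {h} {v} gv≡hv = G.trans (G.sym (⁻¹-involutive g)) (G.trans (G.⁻¹-cong
    (G.sym (inverseʳ-unique _ _ (free {v = g · v} (trans (∙-act g (h ⁻¹) _)
      (trans (cong (λ x → g · h ⁻¹ · x) gv≡hv) (cong (g ·_) (inverse-act h v))))))))
    (⁻¹-involutive h))

  ·-walk : ∀ g {s} → NonBacktrackingWalk Y s → NonBacktrackingWalk Y ((g ·_) ∘ s)
  ·-walk g w = record
    { adjacent = λ i → ·-adj g (adjacent w i)
    ; forward  = λ i eq → forward w i (·-injective g eq)
    }

  module _ (m : ℕ) where

    IsTwisted : Carrier → Pred (ℕ → V Y) _
    IsTwisted g s = NonBacktrackingWalk Y s × (∀ i → s (m + i) ≡ g · s i)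

    Twisted : Carrier → Setoid _ _
    Twisted g = sequences (IsTwisted g)

    twisted-≈ : ∀ {g h s} → g ≈ h → IsTwisted g s → IsTwisted h s
    twisted-≈ {s = s} g≈h (w , tw) = w , λ i → trans (tw i) (·-cong g≈h (s i))

    -- Translation by k turns twist g into twist k g k⁻¹.
    size-conjugate : ∀ {g h} k → k ∙ g ≈ h ∙ k →
                     (E : Enumeration (Twisted g)) (F : Enumeration (Twisted h)) →
                     size E ℕ.≤ size F
    size-conjugate {g} {h} k kg≈hk E F = size-≤ E F
      (λ (s , w , tw) → (k ·_) ∘ s , ·-walk k w , λ i → trans (cong (k ·_) (tw i))
        (trans (sym (∙-act k g (s i))) (trans (·-cong kg≈hk (s i)) (∙-act h k (s i)))))
      (λ _ _ eq i → ·-injective k (eq i))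

  -- The elements act on Y as the deck transformations over Z, each of them once.

  record DeckGroup (Z : Graph) (r : ℕ) : Set (c ⊔ ℓ) where
    field
      projection : Cover Y Z
      elements   : Fin r → Carrier
      distinct   : ∀ {i j} → elements i ≈ elements j → i ≡ j
    open Cover projection public
    field
      invariant  : ∀ i v → map (elements i · v) ≡ map v
      regular    : ∀ {v w} → map v ≡ map w → ∃ λ i → elements i · v ≡ w

  module _ {Z : Graph} {r : ℕ} (D : DeckGroup Z r) (m : ℕ) where
    private
      open module D = DeckGroup D
      open CoverProperties projection

      S : Setoid _ _
      S = sequences (λ s → ∃ λ i → IsTwisted m (elements i) s)

      labelled : Setoid _ _
      labelled = setoid (Fin r) ×ₛ ClosedWalks Z m

      base : V Z → V Y
      base z = proj₁ (surjective z)

      base-over : ∀ z → map (base z) ≡ z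
      base-over z = proj₂ (surjective z) refl

      start : Fin r → (ℕ → V Z) → V Y
      start i t = elements i · base (t 0)

      start-over : ∀ i t → map (start i t) ≡ t 0
      start-over i t = trans (invariant i (base (t 0))) (base-over (t 0))

      twist : ∀ {s} → NonBacktrackingWalk Y s → Periodic m (map ∘ s) → ∃ λ i → IsTwisted m (elements i) s
      twist {s} w pm with i , eq ← regular {s 0} {s (m + 0)} (sym (pm 0)) = i , w ,
        -- The shift by m and the translate by the deck element lie over the same walk of Z and
        -- start at the same vertex.
        lift-unique shifted (·-walk (elements i) w)
          (λ j → trans (pm j) (sym (invariant i (s j)))) (sym eq)
        where
        shifted : NonBacktrackingWalk Y (shift m s)
        shifted = record
          { adjacent = λ j → subst (λ k → Adj Y (s (m + j)) (s k)) (sym (ℕ.+-suc m j)) (adjacent w (m + j))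
          ; forward  = λ j → subst (λ k → s (m + j) ≢ s k)
              (sym (trans (ℕ.+-suc m (suc j)) (cong suc (ℕ.+-suc m j)))) (forward w (m + j))
          }

      -- The label i selects the starting point in the fibre over t(0). The twist of the lift is
      -- another index, fixed by where the lift is after m steps.
      liftₛ : Setoid.Carrier labelled → Setoid.Carrier S
      liftₛ (i , t , w , pt) = lift w (start i t) (start-over i t) ,
        twist (lift-walk w _ _) λ j → trans (lift-over w _ _ (m + j)) (trans (pt j) (sym (lift-over w _ _ j)))

      projects : ∀ x y → Setoid._≈_ S (liftₛ x) (liftₛ y) → Setoid._≈_ labelled x y
      projects (i , t , w , _) (i′ , t′ , w′ , _) eq = i≡i′ , t≗t′
        where
        t≗t′ : t ≗ t′
        t≗t′ j = trans (sym (lift-over w _ (start-over i t) j))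
          (trans (cong map (eq j)) (lift-over w′ _ (start-over i′ t′) j))
        i≡i′ : i ≡ i′
        i≡i′ = distinct (·-unique (trans (eq 0) (cong (λ z → elements i′ · base z) (sym (t≗t′ 0)))))

      lift-cong : ∀ x y → Setoid._≈_ labelled x y → Setoid._≈_ S (liftₛ x) (liftₛ y)
      lift-cong (i , t , w , _) (_ , t′ , w′ , _) (refl , t≗t′) =
        lift-unique (lift-walk w _ _) (lift-walk w′ _ _)
          (λ j → trans (lift-over w _ _ j) (trans (t≗t′ j) (sym (lift-over w′ _ _ j))))
          (cong (λ z → elements i · base z) (t≗t′ 0))

      onto : ∀ y → ∃ λ x → Setoid._≈_ S y (liftₛ x)
      onto (s , i , w , tw) with k , eq ← regular {base (map (s 0))} {s 0} (base-over (map (s 0))) =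
        (k , map ∘ s , map-walk w , λ j → trans (cong map (tw j)) (invariant i (s j))) ,
        lift-unique w (lift-walk _ _ _) (λ j → sym (lift-over (map-walk w) _ _ j)) (sym eq)

    deckWalks : (E : Enumeration (ClosedWalks Z m)) → ∃ λ (F : Enumeration S) → size F ≡ r * size E
    deckWalks E = let F , size≡ = transport {S = labelled} {T = S} liftₛ
                                    (λ {x} {y} → projects x y) (λ {x} {y} → lift-cong x y) onto product
                  in F , trans size≡ (trans (length-cartesianProduct (allFin r) (Enumeration.elements E))
                       (cong (_* size E) {y = r} (List.length-tabulate id)))
      where
      product : Enumeration labelled
      product = record
        { elements = cartesianProduct (allFin r) (Enumeration.elements E)
        ; unique   = Unique.cartesianProduct⁺ (setoid (Fin r)) (ClosedWalks Z m)
                       (UniqueProp.allFin⁺ r) (Enumeration.unique E)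
        ; complete = Enumerates.cartesianProduct⁺ (setoid (Fin r)) (ClosedWalks Z m)
                       ∈-allFin (Enumeration.complete E)
        }

    -- By freeness a walk has at most one twist, so the sizes add up to the number of lifts found in
    -- `deckWalks`.
    twistedCount : (E : Enumeration (ClosedWalks Z m)) (F : ∀ i → Enumeration (Twisted m (elements i))) →
                   ListAction.sum (tabulate (size ∘ F)) ≡ r * size E
    twistedCount E F =
      let U , sizeU = sequences-union (λ i → IsTwisted m (elements i)) disjoint F
          W , sizeW = deckWalks E
      in trans (sym sizeU) (trans (size-≡ U W id id (λ _ _ → id) (λ _ _ → id)) sizeW)
      where
      disjoint : ∀ {s t} i j → s ≗ t → IsTwisted m (elements i) s → IsTwisted m (elements j) t → i ≡ j
      disjoint {s} {t} i j s≗t (_ , ps) (_ , pt) = distinct (·-unique {v = s 0} (trans (sym (ps 0))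
        (trans (s≗t (m + 0)) (trans (pt 0) (cong (elements j ·_) (sym (s≗t 0)))))))

  module _ {r} (D : DeckGroup X r) (everything : ∀ g → ∃ λ i → g ≈ DeckGroup.elements D i) (m : ℕ) where

    -- Every twisted walk is among the finitely many lifts of closed walks of X. Such a lift already
    -- has some twist, so by freeness its twist is g as soon as s(m) = g · s(0), which is decidable
    -- in Y.
    twistedWalks : Enumeration (ClosedWalks X m) → ∀ g → Enumeration (Twisted m g)
    twistedWalks E g = restrict
      (λ tw → let i , g≈ = everything g in i , twisted-≈ m g≈ tw)
      (λ (s , i , w , tw) → Dec.map′
        (λ eq → twisted-≈ m (·-unique (trans (sym (tw 0)) eq)) (w , tw))
        (λ (_ , tw′) → tw′ 0)
        (Graph._≟_ Y (s (m + 0)) (g · s 0)))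
      (λ s≗t (w , tw) → walk-cong s≗t w , λ i → trans (sym (s≗t (m + i))) (trans (tw i) (cong (g ·_) (s≗t i))))
      (proj₁ (deckWalks D m E))

  -- Quotients by subgroups as covers

  module _ (H : DecSubgroup G p) where
    open Quotient action H
    open DecSubgroup H

    quotientCover : Cover Y graph
    quotientCover = record
      { map            = orbit
      ; map-adj        = λ vw → _ , _ , refl , refl , vw
      ; surjective     = λ o → value o , λ { refl → orbit-value o }
      ; star-bijective = λ v → injective v , surjective v
      }
      where
      star : ∀ v → Star Y v → Star graph (orbit v)
      star v = Refinement.map orbit λ vw → _ , _ , refl , refl , vw
      injective : ∀ v {x y} → star v x ≡ star v y → x ≡ y
      injective v {w Refinement., [ vw ]} {w′ Refinement., [ vw′ ]} eq
        with h , _ , refl ← Equivalence.to orbit-≡⇔ (cong value eq) =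
        -- Neighbours of v in one orbit have the same image in X, and the cover of X separates
        -- neighbours.
        Refinement.value-injective (CoverProperties.neighbour-unique cover
          (recompute (Graph.adj? Y v w) vw) (recompute (Graph.adj? Y v w′) vw′) (sym (·-fibre h w)))
      surjective : ∀ v (y : Star graph (orbit v)) → ∃ λ x → ∀ {z} → z ≡ x → star v z ≡ y
      surjective v (o Refinement., [ vo ])
        with v′ , w′ , v′∈ , w′∈ , v′w′ ← recompute (Graph.adj? graph (orbit v) o) vo
        with h , h∈H , refl ← Equivalence.to orbit-≡⇔ v′∈ =
        -- The adjacency of orbits is witnessed by an edge from v′ to w′; the element h carrying v′
        -- to v moves it to an edge at v.
        (h · w′ Refinement., [ ·-adj h v′w′ ]) , λ { refl → Refinement.value-injective
          (trans (sym (Equivalence.from orbit-≡⇔ (h , h∈H , refl))) w′∈) }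

    quotientDeck : ∀ {r} (elements : Fin r → Carrier) → (∀ {i j} → elements i ≈ elements j → i ≡ j) →
                   (∀ i → member (elements i)) → (∀ {g} → member g → ∃ λ i → elements i ≈ g) →
                   DeckGroup graph r
    quotientDeck elements distinct members exhaustive = record
      { projection = quotientCover
      ; elements   = elements
      ; distinct   = distinct
      ; invariant  = λ i v → sym (Equivalence.from orbit-≡⇔ (elements i , members i , refl))
      ; regular    = λ {v} eq → let h , h∈H , hv≡w = Equivalence.to orbit-≡⇔ eq
                                    i , hi≈h = exhaustive h∈H
                                in i , trans (·-cong hi≈h v) hv≡w
      }

  coverDeck : ∀ {r} (elements : Fin r → Carrier) → (∀ {i j} → elements i ≈ elements j → i ≡ j) →
              (∀ g → ∃ λ i → g ≈ elements i) → DeckGroup X r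
  coverDeck elements distinct everything = record
    { projection = cover
    ; elements   = elements
    ; distinct   = distinct
    ; invariant  = λ i → ·-fibre (elements i)
    ; regular    = λ {v} eq → let g , gv≡w = transitive eq
                                  i , g≈ = everything g
                              in i , trans (·-cong (G.sym g≈) v) gv≡w
    }

-- The symmetric group 𝔖 3

-- Ordered by conjugacy class: the identity, the two 3-cycles, the three transpositions. In `σ ∘ₚ τ`
-- the factor σ acts first.
six : Fin 6 → Permutation′ 3
six 0F = Perm.id
six 1F = ⦅123⦆
six 2F = ⦅123⦆ ∘ₚ ⦅123⦆
six 3F = ⦅12⦆
six 4F = ⦅12⦆ ∘ₚ ⦅123⦆
six 5F = ⦅12⦆ ∘ₚ ⦅123⦆ ∘ₚ ⦅123⦆

infix 4 _≈?_
_≈?_ : Decidable (Perm._≈_ {3} {3})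
σ ≈? τ = Fin.all? λ i → (σ ⟨$⟩ʳ i) Fin.≟ (τ ⟨$⟩ʳ i)

six-distinct : ∀ i j → six i Perm.≈ six j → i ≡ j
six-distinct = from-yes (Fin.all? λ i → Fin.all? λ j → (six i ≈? six j) →-dec (i Fin.≟ j))

six-exhaustive : ∀ σ → ∃ λ i → σ Perm.≈ six i
six-exhaustive σ =
  let i , eq₀ , eq₁ , eq₂ = table (σ ⟨$⟩ʳ 0F) (σ ⟨$⟩ʳ 1F) (σ ⟨$⟩ʳ 2F)
        (λ eq → Fin.0≢1+n (injective eq)) (λ eq → Fin.0≢1+n (injective eq))
        (λ eq → Fin.0≢1+n (Fin.suc-injective (injective eq)))
  in i , λ { 0F → eq₀ ; 1F → eq₁ ; 2F → eq₂ }
  where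
  injective : ∀ {x y} → σ ⟨$⟩ʳ x ≡ σ ⟨$⟩ʳ y → x ≡ y
  injective eq = trans (sym (Perm.inverseˡ σ)) (trans (cong (σ ⟨$⟩ˡ_) eq) (Perm.inverseˡ σ))
  table : ∀ (a b c : Fin 3) → a ≢ b → a ≢ c → b ≢ c →
          ∃ λ i → a ≡ six i ⟨$⟩ʳ 0F × b ≡ six i ⟨$⟩ʳ 1F × c ≡ six i ⟨$⟩ʳ 2F
  table = from-yes (Fin.all? λ a → Fin.all? λ b → Fin.all? λ c →
    ¬? (a Fin.≟ b) →-dec (¬? (a Fin.≟ c) →-dec (¬? (b Fin.≟ c) →-dec Fin.any? λ i →
      a Fin.≟ six i ⟨$⟩ʳ 0F ×-dec b Fin.≟ six i ⟨$⟩ʳ 1F ×-dec c Fin.≟ six i ⟨$⟩ʳ 2F)))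

rotation-index : Fin 3 → Fin 6
rotation-index 0F = 0F
rotation-index 1F = 1F
rotation-index 2F = 2F

reflection-index : Fin 2 → Fin 6
reflection-index 0F = 0F
reflection-index 1F = 3F

-- With a₀, a₁, a₃ the values on the three classes, six times either side is 8 a₀ + 4 a₁ + 6 a₃. The
-- factor 6 clears the group orders 6, 3 and 2, so all stays in ℕ.
combine : ∀ {y} x q t (α : Fin 6 → ℕ) → y ≡ α 0F → α 1F ≡ α 2F → α 3F ≡ α 4F → α 3F ≡ α 5F →
          ListAction.sum (List.tabulate α) ≡ 6 * x →
          ListAction.sum (List.tabulate (α ∘ rotation-index)) ≡ 3 * q →
          ListAction.sum (List.tabulate (α ∘ reflection-index)) ≡ 2 * t →
          y + (x + x) ≡ q + (t + t)
combine {y} x q t α refl a₁≡a₂ a₃≡a₄ a₃≡a₅ x≡ q≡ t≡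
  rewrite sym a₁≡a₂ | sym a₃≡a₄ | sym a₃≡a₅ = ℕ.*-cancelˡ-≡ _ _ 6
  (trans (left y x) (trans (cong (λ z → 6 * y + 2 * z) (sym x≡)) (trans (middle y (α 1F) (α 3F))
    (trans (cong₂ (λ z w → 2 * z + 6 * w) q≡ t≡) (sym (right q t))))))
  where
  left : ∀ y x → 6 * (y + (x + x)) ≡ 6 * y + 2 * (6 * x)
  left = ℕ-Solver.solve-∀
  right : ∀ q t → 6 * (q + (t + t)) ≡ 2 * (3 * q) + 6 * (2 * t)
  right = ℕ-Solver.solve-∀
  middle : ∀ a₀ a₁ a₃ → 6 * a₀ + 2 * (a₀ + (a₁ + (a₁ + (a₃ + (a₃ + (a₃ + 0))))))
                      ≡ 2 * (a₀ + (a₁ + (a₁ + 0))) + 6 * (a₀ + (a₃ + 0))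
  middle = ℕ-Solver.solve-∀

-- The four counts for a cover with group 𝔖₃

module _ {c ℓ} {Y X : Graph} {G : Group c ℓ} (p : GaloisCover Y X G)
         {φ : Group.Carrier G → Group.Carrier (𝔖 3)}
         (φ-iso : GroupMorphisms.IsGroupIsomorphism (Group.rawGroup G) (Group.rawGroup (𝔖 3)) φ) where
  open Group G using (Carrier; _≈_; _∙_; ε)
  private module G = Group G
  open GroupMorphisms.IsGroupIsomorphism φ-iso using (isGroupHomomorphism; injective; surjective)
  open GroupMorphisms.IsGroupHomomorphism isGroupHomomorphism using (⟦⟧-cong; homo; ε-homo)
  open GaloisCover p
  open FibrewiseRegularAction action

  element : Fin 6 → Carrier
  element i = proj₁ (surjective (six i))

  φ-element : ∀ i → φ (element i) Perm.≈ six i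
  φ-element i = proj₂ (surjective (six i)) G.refl

  element-distinct : ∀ {i j} → element i ≈ element j → i ≡ j
  element-distinct {i} {j} eq = six-distinct i j λ x →
    trans (sym (φ-element i x)) (trans (⟦⟧-cong eq x) (φ-element j x))

  element-exhaustive : ∀ g → ∃ λ i → g ≈ element i
  element-exhaustive g = let i , eq = six-exhaustive (φ g) in
    i , injective λ x → trans (eq x) (sym (φ-element i x))

  conjugates : ∀ k i j → (six i ∘ₚ six k) Perm.≈ (six k ∘ₚ six j) →
               element k ∙ element i ≈ element j ∙ element k
  conjugates k i j eq = injective λ x → trans (product k i x) (trans (eq x) (sym (product j k x)))
    where
    product : ∀ i j → φ (element i ∙ element j) Perm.≈ (six j ∘ₚ six i)
    product i j x = trans (homo (element i) (element j) x)
      (trans (cong (φ (element i) ⟨$⟩ʳ_) (φ-element j x)) (φ-element i (six j ⟨$⟩ʳ x)))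

  element-0 : element 0F ≈ ε
  element-0 = injective λ x → trans (φ-element 0F x) (sym (ε-homo x))

  baseDeck : DeckGroup action X 6
  baseDeck = coverDeck action element element-distinct element-exhaustive

  subgroupDeck : ∀ {r} (H : DecSubgroup (𝔖 3) 0ℓ) (index : Fin r → Fin 6) →
    (∀ i j → index i ≡ index j → i ≡ j) → (∀ i → DecSubgroup.member H (six (index i))) →
    (∀ j → DecSubgroup.member H (six j) → ∃ λ i → index i ≡ j) →
    DeckGroup action (p / preimage φ-iso H) r
  subgroupDeck H index index-injective members exhaustive = quotientDeck action (preimage φ-iso H)
    (element ∘ index)
    (λ {i} {j} eq → index-injective i j (element-distinct {index i} {index j} eq))
    (λ i → H.resp {six (index i)} {φ (element (index i))} (λ x → sym (φ-element (index i) x)) (members i))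
    (λ {g} g∈H →
      let j , g≈ = element-exhaustive g
          i , eq = exhaustive j (H.resp {φ g} {six j} (λ x → trans (⟦⟧-cong g≈ x) (φ-element j x)) g∈H)
      in i , G.trans (G.reflexive (cong element eq)) (G.sym g≈))
    where module H = DecSubgroup H

  rotationDeck : DeckGroup action (p / preimage φ-iso C₃) 3
  rotationDeck = subgroupDeck C₃ rotation-index
    (from-yes (Fin.all? λ i → Fin.all? λ j → (rotation-index i Fin.≟ rotation-index j) →-dec (i Fin.≟ j)))
    (from-yes (Fin.all? λ i → DecSubgroup.member? C₃ (six (rotation-index i))))
    (from-yes (Fin.all? λ j → DecSubgroup.member? C₃ (six j) →-dec Fin.any? λ i → rotation-index i Fin.≟ j))

  reflectionDeck : DeckGroup action (p / preimage φ-iso C₂) 2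
  reflectionDeck = subgroupDeck C₂ reflection-index
    (from-yes (Fin.all? λ i → Fin.all? λ j → (reflection-index i Fin.≟ reflection-index j) →-dec (i Fin.≟ j)))
    (from-yes (Fin.all? λ i → DecSubgroup.member? C₂ (six (reflection-index i))))
    (from-yes (Fin.all? λ j → DecSubgroup.member? C₂ (six j) →-dec Fin.any? λ i → reflection-index i Fin.≟ j))

  module _ (m : ℕ) (count : Graph → ℕ) (walks : ∀ Γ → Enumeration (ClosedWalks Γ m))
           (size-walks : ∀ Γ → size (walks Γ) ≡ count Γ)
           (twisted : ∀ i → Enumeration (Twisted action m (element i))) where
    private
      α : Fin 6 → ℕ
      α i = size (twisted i)

      α-conjugate : ∀ k k′ i j → {True ((six i ∘ₚ six k) ≈? (six k ∘ₚ six j))} →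
                    {True ((six j ∘ₚ six k′) ≈? (six k′ ∘ₚ six i))} → α i ≡ α j
      α-conjugate k k′ i j {ki≈jk} {k′j≈ik′} = ℕ.≤-antisym
        (size-conjugate action m (element k) (conjugates k i j (toWitness ki≈jk)) (twisted i) (twisted j))
        (size-conjugate action m (element k′) (conjugates k′ j i (toWitness k′j≈ik′)) (twisted j) (twisted i))

      over : ∀ {Z r} (D : DeckGroup action Z r)
             (F : ∀ i → Enumeration (Twisted action m (DeckGroup.elements D i))) →
             ListAction.sum (List.tabulate (size ∘ F)) ≡ r * count Z
      over {Z} {r} D F = trans (twistedCount action D m (walks Z) F) (cong (r *_) (size-walks Z))

      untwisted : count Y ≡ α 0F
      untwisted = trans (sym (size-walks Y)) (size-≡ (walks Y) (twisted 0F)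
        (λ (s , w , ps) → s , w , λ i → trans (ps i) (sym (trans (·-cong element-0 (s i)) (ε-act (s i)))))
        (λ (s , w , tw) → s , w , λ i → trans (tw i) (trans (·-cong element-0 (s i)) (ε-act (s i))))
        (λ _ _ → id) (λ _ _ → id))

    count-relation : let Q = p / preimage φ-iso C₃
                         T = p / preimage φ-iso C₂
                     in count Y + (count X + count X) ≡ count Q + (count T + count T)
    count-relation = combine (count X) (count (p / preimage φ-iso C₃)) (count (p / preimage φ-iso C₂))
      α untwisted
      -- The transposition (1 2) inverts (1 2 3), in both directions. The two 3-cycles, inverse to
      -- each other, carry (1 2) to the remaining transpositions and back.
      (α-conjugate 3F 3F 1F 2F) (α-conjugate 2F 1F 3F 4F) (α-conjugate 1F 2F 3F 5F)
      (over baseDeck twisted)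
      (over rotationDeck (twisted ∘ rotation-index))
      (over reflectionDeck (twisted ∘ reflection-index))

-- A record, so that the four graphs are inferred without unfolding the counts.

record CountRelation (Y X Q T : Graph) : Set where
  field
    relation : ∀ m → closedWalkCount Y m + (closedWalkCount X m + closedWalkCount X m)
                   ≡ closedWalkCount Q m + (closedWalkCount T m + closedWalkCount T m)

closedWalkCount-relation :
    ∀ {c ℓ} {Y X : Graph} {G : Group c ℓ} (p : GaloisCover Y X G)
      {φ : Group.Carrier G → Group.Carrier (𝔖 3)}
      (φ-iso : GroupMorphisms.IsGroupIsomorphism (Group.rawGroup G) (Group.rawGroup (𝔖 3)) φ) →
    let Q = p / preimage φ-iso C₃
        T = p / preimage φ-iso C₂
    in CountRelation Y X Q T
closedWalkCount-relation {Y = Y} {X} p φ-iso = record { relation = relation }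
  where
  relation : ∀ m → _
  relation zero      = refl
  relation m@(suc _) = count-relation p φ-iso m (λ Γ → closedWalkCount Γ m) walks
    (λ Γ → size-closedWalks Γ m (walks Γ))
    (λ i → twistedWalks action (baseDeck p φ-iso) (element-exhaustive p φ-iso) m (walks X) (element p φ-iso i))
    where
    open GaloisCover p
    walks : ∀ Γ → Enumeration (ClosedWalks Γ m)
    walks Γ = proj₁ (closedWalks Γ {m} m ℕ.≤-refl)

ζ-relation : ∀ {Y X Q T} → CountRelation Y X Q T → ζ Y ⊛ (ζ X ⊛ ζ X) ≋ ζ Q ⊛ (ζ T ⊛ ζ T)
ζ-relation {Y} {X} {Q} {T} counts n = logDerivative-unique
  -- Both `refl` hold by computation: the counts are 0 at degree 0, and coefficient 0 of each `ζ` is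
  -- that of the empty product.
  {logDerivative Y X} {logDerivative Q T} {ζ Y ⊛ (ζ X ⊛ ζ X)} {ζ Q ⊛ (ζ T ⊛ ζ T)} n refl refl
  (λ m _ → cong +_ (CountRelation.relation counts m))
  (λ i _ → isLogDerivative Y X i) (λ i _ → isLogDerivative Q T i)
  where
  logDerivative : Graph → Graph → PowerSeries
  logDerivative Γ Δ m = + (closedWalkCount Γ m + (closedWalkCount Δ m + closedWalkCount Δ m))
  isLogDerivative : ∀ Γ Δ → IsLogDerivative (logDerivative Γ Δ) (ζ Γ ⊛ (ζ Δ ⊛ ζ Δ))
  isLogDerivative Γ Δ = logDerivative-⊛ {+_ ∘ closedWalkCount Γ} {ζ Γ}
    {(+_ ∘ closedWalkCount Δ) ⊕ (+_ ∘ closedWalkCount Δ)} {ζ Δ ⊛ ζ Δ} (ζ-logDerivative Γ)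
    (logDerivative-⊛ {+_ ∘ closedWalkCount Δ} {ζ Δ} {+_ ∘ closedWalkCount Δ} {ζ Δ}
      (ζ-logDerivative Δ) (ζ-logDerivative Δ))

theorem7 :
    ∀ {c ℓ} {Y X : Graph} {G : Group c ℓ} (p : GaloisCover Y X G)
      {φ : Group.Carrier G → Group.Carrier (𝔖 3)}
      (φ-iso : GroupMorphisms.IsGroupIsomorphism (Group.rawGroup G) (Group.rawGroup (𝔖 3)) φ) →
    let Q = p / preimage φ-iso C₃
        T = p / preimage φ-iso C₂
    in ζ Y ⊛ (ζ X ⊛ ζ X) ≋ ζ Q ⊛ (ζ T ⊛ ζ T)
theorem7 p φ-iso = ζ-relation (closedWalkCount-relation p φ-iso)
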